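{- Let $H$ be a real symmetric matrix indexed by a finite set $V$ and let $a,b\in V$ be distinct. If $a,b$ are not strongly cospectral for $H$, then $\mathcal G(H;a,b)=\varnothing$. Otherwise, write $E_\lambda e_b=\sigma_\lambda E_\lambda e_a$ with $\sigma_\lambda\in\{1,-1\}$ for $\lambda$ in the common eigenvalue support of $a,b$, and consider the condition \[ (\ast)\qquad \sigma_\rho=\sigma_{ -\rho}\quad\text{whenever both }\rho\text{ and }-\rho\text{ occur in the common eigenvalue support of }a,b. \] Then \[ \mathcal G(H;a,b)=\begin{cases}\mathbb N^+,&\text{if }(\ast)\text{ holds},\\ 2\mathbb N+1,&\text{otherwise.}\end{cases} \]
   Context: $\mathbb N=\{0,1,2,\ldots\}$ and $\mathbb N^+=\{1,2,3,\ldots\}$. $e_v$ denotes the standard basis vector indexed by $v\in V$. For a real symmetric matrix $H$ with spectral decomposition $H=\sum_{\lambda\in\operatorname{Spec}(H)}\lambda E_\lambda$ ($E_\lambda$ the orthogonal projection onto the $\lambda$-eigenspace), and a vector $x$, put $\operatorname{supp}_H(x)=\{\lambda\in\operatorname{Spec}(H):E_\lambda x\neq 0\}$. Vertices $a,b$ are strongly cospectral for $H$ if $\operatorname{supp}_H(e_a)=\operatorname{supp}_H(e_b)$ (the common eigenvalue support) and for each $\lambda$ in it $E_\lambda e_b=\sigma_\lambda E_\lambda e_a$ with some $\sigma_\lambda\in\{1,-1\}$. $\mathcal G(H;a,b)=\{k\in\mathbb N^+: a,b\text{ are strongly cospectral for }H^k\}$. -}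

module Defs where

open import Algebra.Bundles using (CommutativeRing)
import Algebra.Consequences.Setoid as Consequences
import Algebra.Definitions.RawMonoid as RawMonoidDefs
open import Data.Bool.Base using (if_then_else_)
open import Data.Fin.Base using (Fin)
import Data.Fin.Properties as Fin
open import Data.Nat.Base as ℕ using (ℕ; zero; suc; _≥_; _⊔_)
import Data.Nat.Properties as ℕ
open import Data.Product.Base using (∃; ∃-syntax; _×_; _,_)
open import Data.Rational.Base as ℚ using (ℚ; 0ℚ; 1ℚ; ½; ∣_∣)
import Data.Rational.Properties as ℚ
open import Data.Rational.Solver using (module +-*-Solver)
open import Data.Sign.Base using (Sign)
open import Function.Bundles using (_↔_; Inverse)
open import Level using (0ℓ)
open import Relation.Binary.Bundles using (Setoid)
open import Relation.Binary.PropositionalEquality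
open import Relation.Nullary.Decidable.Core using (does)
open import Relation.Nullary.Negation.Core using (¬_)
open import Relation.Unary using (Pred; _∈_; _≐_)

------------------------------------------------------------------------
-- The real numbers, as Cauchy sequences of rationals modulo null
-- sequences.  The quotient is expressed by the setoid equality _≈ᴿ_.

Close : ℚ → ℚ → ℚ → Set
Close ε p q = ∣ p ℚ.- q ∣ ℚ.< ε

IsCauchy : (ℕ → ℚ) → Set
IsCauchy x = ∀ ε → 0ℚ ℚ.< ε →
  ∃[ N ] (∀ m n → m ≥ N → n ≥ N → Close ε (x m) (x n))

record ℝ : Set where
  constructor mkℝ
  field
    seq    : ℕ → ℚ
    cauchy : IsCauchy seq

open ℝ public

IsClose : (ℕ → ℚ) → (ℕ → ℚ) → Set
IsClose x y = ∀ ε → 0ℚ ℚ.< ε →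
  ∃[ N ] (∀ n → n ≥ N → Close ε (x n) (y n))

infix 4 _≈ᴿ_

record _≈ᴿ_ (x y : ℝ) : Set where
  constructor mk≈
  field
    close : IsClose (seq x) (seq y)

open _≈ᴿ_ public

module Estimates where
  ½+½≡1 : ½ ℚ.+ ½ ≡ 1ℚ
  ½+½≡1 = refl

  split-eq : ∀ h B ε i → h ℚ.+ h ≡ 1ℚ → B ℚ.* i ≡ 1ℚ →
             B ℚ.* (h ℚ.* ε ℚ.* i) ℚ.+ B ℚ.* (h ℚ.* ε ℚ.* i) ≡ ε
  split-eq h B ε i hh Bi = begin
    B ℚ.* (h ℚ.* ε ℚ.* i) ℚ.+ B ℚ.* (h ℚ.* ε ℚ.* i)
      ≡⟨ solve 4 (λ h b e i → b :* (h :* e :* i) :+ b :* (h :* e :* i)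
                              := (h :+ h) :* ((b :* i) :* e)) refl h B ε i ⟩
    (h ℚ.+ h) ℚ.* ((B ℚ.* i) ℚ.* ε)
      ≡⟨ cong₂ (λ p q → p ℚ.* (q ℚ.* ε)) hh Bi ⟩
    1ℚ ℚ.* (1ℚ ℚ.* ε)
      ≡⟨ trans (ℚ.*-identityˡ (1ℚ ℚ.* ε)) (ℚ.*-identityˡ ε) ⟩
    ε ∎
    where
    open +-*-Solver
    open ≡-Reasoning

  split : ∀ B ε → 0ℚ ℚ.< B → 0ℚ ℚ.< ε →
          ∃[ δ ] (0ℚ ℚ.< δ × B ℚ.* δ ℚ.+ B ℚ.* δ ≡ ε)
  split B ε B>0 ε>0 = ½ ℚ.* ε ℚ.* i , δ>0 , split-eq ½ B ε i ½+½≡1 B*i≡1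
    where
    i = (ℚ.1/ B) {{ℚ.pos⇒nonZero B {{ℚ.positive B>0}}}}
    B*i≡1 : B ℚ.* i ≡ 1ℚ
    B*i≡1 = ℚ.*-inverseʳ B {{ℚ.pos⇒nonZero B {{ℚ.positive B>0}}}}
    δ>0 : 0ℚ ℚ.< ½ ℚ.* ε ℚ.* i
    δ>0 = ℚ.positive⁻¹ _
      {{ℚ.pos*pos⇒pos (½ ℚ.* ε) {{ℚ.pos*pos⇒pos ½ ε {{ℚ.positive ε>0}}}}
                      i {{ℚ.1/pos⇒pos B {{ℚ.positive B>0}}}}}}

  0<1 : 0ℚ ℚ.< 1ℚ
  0<1 = ℚ.positive⁻¹ 1ℚ

  halve : ∀ ε → 0ℚ ℚ.< ε → ∃[ δ ] (0ℚ ℚ.< δ × δ ℚ.+ δ ≡ ε)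
  halve ε ε>0 = ½ ℚ.* ε , ℚ.positive⁻¹ _ {{ℚ.pos*pos⇒pos ½ ε {{ℚ.positive ε>0}}}} ,
    trans (sym (ℚ.*-distribʳ-+ ε ½ ½)) (trans (cong (ℚ._* ε) ½+½≡1) (ℚ.*-identityˡ ε))

  module _ where
    open ℚ.≤-Reasoning
    open +-*-Solver

    close-refl : ∀ {ε} p → 0ℚ ℚ.< ε → Close ε p p
    close-refl p ε>0 = subst (ℚ._< _) (cong ∣_∣ (sym (ℚ.+-inverseʳ p))) ε>0

    close-sym : ∀ {ε} p q → Close ε p q → Close ε q p
    close-sym p q pq = subst (ℚ._< _)
      (trans (sym (ℚ.∣-p∣≡∣p∣ (p ℚ.- q)))
             (cong ∣_∣ (solve 2 (λ p q → :- (p :- q) := q :- p) refl p q))) pq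

    close-sum : ∀ {δ ε} a b c → c ≡ a ℚ.+ b → ∣ a ∣ ℚ.< δ → ∣ b ∣ ℚ.< δ →
                δ ℚ.+ δ ≡ ε → ∣ c ∣ ℚ.< ε
    close-sum {δ} {ε} a b c c≡ a< b< δδ = begin-strict
      ∣ c ∣             ≡⟨ cong ∣_∣ c≡ ⟩
      ∣ a ℚ.+ b ∣       ≤⟨ ℚ.∣p+q∣≤∣p∣+∣q∣ a b ⟩
      ∣ a ∣ ℚ.+ ∣ b ∣   <⟨ ℚ.+-mono-< a< b< ⟩
      δ ℚ.+ δ           ≡⟨ δδ ⟩
      ε                 ∎

    close-trans : ∀ {δ ε} p q r → Close δ p q → Close δ q r → δ ℚ.+ δ ≡ ε →
                  Close ε p r
    close-trans p q r = close-sum (p ℚ.- q) (q ℚ.- r) (p ℚ.- r)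
      (solve 3 (λ p q r → p :- r := (p :- q) :+ (q :- r)) refl p q r)

    close-+ : ∀ {δ ε} p q r s → Close δ p q → Close δ r s → δ ℚ.+ δ ≡ ε →
              Close ε (p ℚ.+ r) (q ℚ.+ s)
    close-+ p q r s = close-sum (p ℚ.- q) (r ℚ.- s) _
      (solve 4 (λ p q r s → (p :+ r) :- (q :+ s) := (p :- q) :+ (r :- s))
               refl p q r s)

    close-neg : ∀ {ε} p q → Close ε p q → Close ε (ℚ.- p) (ℚ.- q)
    close-neg p q pq = subst (ℚ._< _)
      (cong ∣_∣ (solve 2 (λ p q → q :- p := :- p :- :- q) refl p q))
      (close-sym p q pq)

    close-scale : ∀ {B δ} a d → 0ℚ ℚ.< B → ∣ a ∣ ℚ.≤ B → ∣ d ∣ ℚ.< δ →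
                  ∣ a ℚ.* d ∣ ℚ.< B ℚ.* δ
    close-scale {B} {δ} a d B>0 a≤ d< = begin-strict
      ∣ a ℚ.* d ∣       ≡⟨ ℚ.∣p*q∣≡∣p∣*∣q∣ a d ⟩
      ∣ a ∣ ℚ.* ∣ d ∣   ≤⟨ ℚ.*-monoʳ-≤-nonNeg ∣ d ∣ {{ℚ.∣-∣-nonNeg d}} a≤ ⟩
      B ℚ.* ∣ d ∣       <⟨ ℚ.*-monoʳ-<-pos B {{ℚ.positive B>0}} d< ⟩
      B ℚ.* δ           ∎

    close-* : ∀ {B δ ε} p q r s → 0ℚ ℚ.< B → ∣ p ∣ ℚ.≤ B → ∣ s ∣ ℚ.≤ B →
              Close δ p q → Close δ r s → B ℚ.* δ ℚ.+ B ℚ.* δ ≡ ε →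
              Close ε (p ℚ.* r) (q ℚ.* s)
    close-* p q r s B>0 p≤ s≤ pq rs = close-sum (p ℚ.* (r ℚ.- s)) (s ℚ.* (p ℚ.- q)) _
      (solve 4 (λ p q r s → p :* r :- q :* s := p :* (r :- s) :+ s :* (p :- q))
               refl p q r s)
      (close-scale p (r ℚ.- s) B>0 p≤ rs)
      (close-scale s (p ℚ.- q) B>0 s≤ pq)

    bounded : ∀ (x : ℝ) →
      ∃[ B ] (0ℚ ℚ.< B × ∃[ N ] (∀ n → n ≥ N → ∣ seq x n ∣ ℚ.≤ B))
    bounded x with cauchy x 1ℚ 0<1
    ... | N , near = 1ℚ ℚ.+ ∣ c ∣ , B>0 , N , bnd
      where
      c = seq x N
      B>0 : 0ℚ ℚ.< 1ℚ ℚ.+ ∣ c ∣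
      B>0 = ℚ.+-mono-<-≤ 0<1 (ℚ.0≤∣p∣ c)
      bnd : ∀ n → n ≥ N → ∣ seq x n ∣ ℚ.≤ 1ℚ ℚ.+ ∣ c ∣
      bnd n n≥N = begin
        ∣ p ∣                   ≡⟨ cong ∣_∣ (solve 2 (λ p c → p := (p :- c) :+ c) refl p c) ⟩
        ∣ (p ℚ.- c) ℚ.+ c ∣     ≤⟨ ℚ.∣p+q∣≤∣p∣+∣q∣ (p ℚ.- c) c ⟩
        ∣ p ℚ.- c ∣ ℚ.+ ∣ c ∣   ≤⟨ ℚ.+-monoˡ-≤ ∣ c ∣ (ℚ.<⇒≤ (near n N n≥N ℕ.≤-refl)) ⟩
        1ℚ ℚ.+ ∣ c ∣            ∎
        where p = seq x n

    Bounded : (ℕ → ℚ) → Set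
    Bounded x = ∃[ B ] (0ℚ ℚ.< B × ∃[ N ] (∀ n → n ≥ N → ∣ x n ∣ ℚ.≤ B))

    Bounded₂ : (ℕ → ℚ) → (ℕ → ℚ) → Set
    Bounded₂ x y = ∃[ B ] (0ℚ ℚ.< B ×
      ∃[ N ] (∀ n → n ≥ N → ∣ x n ∣ ℚ.≤ B × ∣ y n ∣ ℚ.≤ B))

    combine : ∀ {x y} → Bounded x → Bounded y → Bounded₂ x y
    combine {x} {y} (B , B>0 , M , bx) (C , C>0 , N , by) =
      B ℚ.+ C , ℚ.+-mono-< B>0 C>0 , M ⊔ N , λ n n≥ →
        (begin
          ∣ x n ∣      ≤⟨ bx n (ℕ.m⊔n≤o⇒m≤o M N n≥) ⟩
          B            ≡⟨ ℚ.+-identityʳ B ⟨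
          B ℚ.+ 0ℚ     ≤⟨ ℚ.+-monoʳ-≤ B (ℚ.<⇒≤ C>0) ⟩
          B ℚ.+ C      ∎) ,
        (begin
          ∣ y n ∣      ≤⟨ by n (ℕ.m⊔n≤o⇒n≤o M N n≥) ⟩
          C            ≡⟨ ℚ.+-identityˡ C ⟨
          0ℚ ℚ.+ C     ≤⟨ ℚ.+-monoˡ-≤ C (ℚ.<⇒≤ B>0) ⟩
          B ℚ.+ C      ∎)

    bounded₂ : ∀ (x y : ℝ) → Bounded₂ (seq x) (seq y)
    bounded₂ x y = combine (bounded x) (bounded y)

  pointwise : ∀ x y → (∀ n → seq x n ≡ seq y n) → x ≈ᴿ y
  pointwise x y eq = mk≈ λ ε ε>0 → 0 , λ n _ →
    subst (Close ε (seq x n)) (eq n) (close-refl (seq x n) ε>0)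

  ≈-sym′ : ∀ {x y} → x ≈ᴿ y → y ≈ᴿ x
  ≈-sym′ {x} {y} x≈y = mk≈ λ ε ε>0 → let N , f = close x≈y ε ε>0 in
    N , λ n n≥ → close-sym (seq x n) (seq y n) (f n n≥)

  ≈-trans′ : ∀ {x y z} → x ≈ᴿ y → y ≈ᴿ z → x ≈ᴿ z
  ≈-trans′ {x} {y} {z} x≈y y≈z = mk≈ λ ε ε>0 →
    let δ , δ>0 , δδ = halve ε ε>0
        M , f = close x≈y δ δ>0
        N , g = close y≈z δ δ>0
    in M ⊔ N , λ n n≥ → close-trans (seq x n) (seq y n) (seq z n)
         (f n (ℕ.m⊔n≤o⇒m≤o M N n≥)) (g n (ℕ.m⊔n≤o⇒n≤o M N n≥)) δδ

open Estimates

fromℚ : ℚ → ℝ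
fromℚ p = mkℝ (λ _ → p) λ ε ε>0 → 0 , λ _ _ _ _ → close-refl p ε>0

infixl 6 _+ᴿ_
infixl 7 _*ᴿ_
infix  8 -ᴿ_

-- Opaque, so that unification does not descend into rational arithmetic.
opaque

  _+ᴿ_ : ℝ → ℝ → ℝ
  x +ᴿ y = mkℝ (λ n → seq x n ℚ.+ seq y n) λ ε ε>0 →
    let δ , δ>0 , δδ = halve ε ε>0
        M , f = cauchy x δ δ>0
        N , g = cauchy y δ δ>0
    in M ⊔ N , λ m n m≥ n≥ →
         close-+ (seq x m) (seq x n) (seq y m) (seq y n)
           (f m n (ℕ.m⊔n≤o⇒m≤o M N m≥) (ℕ.m⊔n≤o⇒m≤o M N n≥))
           (g m n (ℕ.m⊔n≤o⇒n≤o M N m≥) (ℕ.m⊔n≤o⇒n≤o M N n≥)) δδ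

  -ᴿ_ : ℝ → ℝ
  -ᴿ x = mkℝ (λ n → ℚ.- seq x n) λ ε ε>0 →
    let N , f = cauchy x ε ε>0
    in N , λ m n m≥ n≥ → close-neg (seq x m) (seq x n) (f m n m≥ n≥)

  _*ᴿ_ : ℝ → ℝ → ℝ
  x *ᴿ y = mkℝ (λ n → seq x n ℚ.* seq y n) λ ε ε>0 →
    let B , B>0 , K , bd = bounded₂ x y
        δ , δ>0 , δδ = split B ε B>0 ε>0
        M , f = cauchy x δ δ>0
        N , g = cauchy y δ δ>0
        L = M ⊔ N
    in K ⊔ L , λ m n m≥ n≥ →
         let mL = ℕ.m⊔n≤o⇒n≤o K L m≥
             nL = ℕ.m⊔n≤o⇒n≤o K L n≥
             xm≤ , _ = bd m (ℕ.m⊔n≤o⇒m≤o K L m≥)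
             _ , yn≤ = bd n (ℕ.m⊔n≤o⇒m≤o K L n≥)
         in close-* (seq x m) (seq x n) (seq y m) (seq y n) B>0 xm≤ yn≤
              (f m n (ℕ.m⊔n≤o⇒m≤o M N mL) (ℕ.m⊔n≤o⇒m≤o M N nL))
              (g m n (ℕ.m⊔n≤o⇒n≤o M N mL) (ℕ.m⊔n≤o⇒n≤o M N nL)) δδ

private
  module _ {x y u v : ℕ → ℚ} where

    +-close : IsClose x y → IsClose u v →
              IsClose (λ n → x n ℚ.+ u n) (λ n → y n ℚ.+ v n)
    +-close x≈y u≈v ε ε>0 =
      let δ , δ>0 , δδ = halve ε ε>0
          M , f = x≈y δ δ>0
          N , g = u≈v δ δ>0
      in M ⊔ N , λ n n≥ → close-+ (x n) (y n) (u n) (v n)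
           (f n (ℕ.m⊔n≤o⇒m≤o M N n≥)) (g n (ℕ.m⊔n≤o⇒n≤o M N n≥)) δδ

    neg-close : IsClose x y → IsClose (λ n → ℚ.- x n) (λ n → ℚ.- y n)
    neg-close x≈y ε ε>0 = let N , f = x≈y ε ε>0 in
      N , λ n n≥ → close-neg (x n) (y n) (f n n≥)

    *-close : Bounded₂ x v → IsClose x y → IsClose u v →
              IsClose (λ n → x n ℚ.* u n) (λ n → y n ℚ.* v n)
    *-close (B , B>0 , K , bd) x≈y u≈v ε ε>0 =
      let δ , δ>0 , δδ = split B ε B>0 ε>0
          M , f = x≈y δ δ>0
          N , g = u≈v δ δ>0
          L = M ⊔ N
      in K ⊔ L , λ n n≥ →
           let nL = ℕ.m⊔n≤o⇒n≤o K L n≥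
               xn≤ , vn≤ = bd n (ℕ.m⊔n≤o⇒m≤o K L n≥)
           in close-* (x n) (y n) (u n) (v n) B>0 xn≤ vn≤
                (f n (ℕ.m⊔n≤o⇒m≤o M N nL)) (g n (ℕ.m⊔n≤o⇒n≤o M N nL)) δδ

  opaque
    unfolding _+ᴿ_ -ᴿ_ _*ᴿ_

    +ᴿ-cong : ∀ {x y u v} → x ≈ᴿ y → u ≈ᴿ v → x +ᴿ u ≈ᴿ y +ᴿ v
    +ᴿ-cong {x} {y} {u} {v} (mk≈ x≈y) (mk≈ u≈v) =
      mk≈ (+-close {seq x} {seq y} {seq u} {seq v} x≈y u≈v)

    -ᴿ-cong : ∀ {x y} → x ≈ᴿ y → -ᴿ x ≈ᴿ -ᴿ y
    -ᴿ-cong {x} {y} (mk≈ x≈y) = mk≈ (neg-close {seq x} {seq y} {seq x} {seq x} x≈y)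

    *ᴿ-cong : ∀ {x y u v} → x ≈ᴿ y → u ≈ᴿ v → x *ᴿ u ≈ᴿ y *ᴿ v
    *ᴿ-cong {x} {y} {u} {v} (mk≈ x≈y) (mk≈ u≈v) =
      mk≈ (*-close {seq x} {seq y} {seq u} {seq v} (bounded₂ x v) x≈y u≈v)

    +ᴿ-assoc : ∀ x y z → (x +ᴿ y) +ᴿ z ≈ᴿ x +ᴿ (y +ᴿ z)
    +ᴿ-assoc x y z = pointwise ((x +ᴿ y) +ᴿ z) (x +ᴿ (y +ᴿ z)) λ n →
      ℚ.+-assoc (seq x n) (seq y n) (seq z n)

    +ᴿ-comm : ∀ x y → x +ᴿ y ≈ᴿ y +ᴿ x
    +ᴿ-comm x y = pointwise (x +ᴿ y) (y +ᴿ x) λ n → ℚ.+-comm (seq x n) (seq y n)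

    +ᴿ-identityˡ : ∀ x → fromℚ 0ℚ +ᴿ x ≈ᴿ x
    +ᴿ-identityˡ x = pointwise (fromℚ 0ℚ +ᴿ x) x λ n → ℚ.+-identityˡ (seq x n)

    +ᴿ-inverseˡ : ∀ x → -ᴿ x +ᴿ x ≈ᴿ fromℚ 0ℚ
    +ᴿ-inverseˡ x = pointwise (-ᴿ x +ᴿ x) (fromℚ 0ℚ) λ n → ℚ.+-inverseˡ (seq x n)

    *ᴿ-assoc : ∀ x y z → (x *ᴿ y) *ᴿ z ≈ᴿ x *ᴿ (y *ᴿ z)
    *ᴿ-assoc x y z = pointwise ((x *ᴿ y) *ᴿ z) (x *ᴿ (y *ᴿ z)) λ n →
      ℚ.*-assoc (seq x n) (seq y n) (seq z n)

    *ᴿ-comm : ∀ x y → x *ᴿ y ≈ᴿ y *ᴿ x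
    *ᴿ-comm x y = pointwise (x *ᴿ y) (y *ᴿ x) λ n → ℚ.*-comm (seq x n) (seq y n)

    *ᴿ-identityˡ : ∀ x → fromℚ 1ℚ *ᴿ x ≈ᴿ x
    *ᴿ-identityˡ x = pointwise (fromℚ 1ℚ *ᴿ x) x λ n → ℚ.*-identityˡ (seq x n)

    *ᴿ-distribˡ : ∀ x y z → x *ᴿ (y +ᴿ z) ≈ᴿ x *ᴿ y +ᴿ x *ᴿ z
    *ᴿ-distribˡ x y z = pointwise (x *ᴿ (y +ᴿ z)) (x *ᴿ y +ᴿ x *ᴿ z) λ n →
      ℚ.*-distribˡ-+ (seq x n) (seq y n) (seq z n)

  ≈ᴿ-setoid : Setoid 0ℓ 0ℓ
  ≈ᴿ-setoid = record
    { Carrier = ℝ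
    ; _≈_ = _≈ᴿ_
    ; isEquivalence = record
      { refl  = λ {x} → pointwise x x λ _ → refl
      ; sym   = ≈-sym′
      ; trans = ≈-trans′
      }
    }

open Consequences ≈ᴿ-setoid

ℝ-commutativeRing : CommutativeRing 0ℓ 0ℓ
ℝ-commutativeRing = record
  { Carrier = ℝ
  ; _≈_     = _≈ᴿ_
  ; _+_     = _+ᴿ_
  ; _*_     = _*ᴿ_
  ; -_      = -ᴿ_
  ; 0#      = fromℚ 0ℚ
  ; 1#      = fromℚ 1ℚ
  ; isCommutativeRing = record
    { isRing = record
      { +-isAbelianGroup = record
        { isGroup = record
          { isMonoid = record
            { isSemigroup = record
              { isMagma = record
                { isEquivalence = Setoid.isEquivalence ≈ᴿ-setoid
                ; ∙-cong        = +ᴿ-cong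
                }
              ; assoc = +ᴿ-assoc
              }
            ; identity = comm∧idˡ⇒id +ᴿ-comm +ᴿ-identityˡ
            }
          ; inverse = comm∧invˡ⇒inv +ᴿ-comm +ᴿ-inverseˡ
          ; ⁻¹-cong = -ᴿ-cong
          }
        ; comm = +ᴿ-comm
        }
      ; *-cong     = *ᴿ-cong
      ; *-assoc    = *ᴿ-assoc
      ; *-identity = comm∧idˡ⇒id *ᴿ-comm *ᴿ-identityˡ
      ; distrib    = comm∧distrˡ⇒distr +ᴿ-cong *ᴿ-comm *ᴿ-distribˡ
      }
    ; *-comm = *ᴿ-comm
    }
  }

open CommutativeRing ℝ-commutativeRing
  using (_≈_; _+_; _*_; _-_; -_; 0#; 1#; +-rawMonoid)
open RawMonoidDefs +-rawMonoid using (sum)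

⟦_⟧ : Sign → ℝ
⟦ Sign.+ ⟧ = 1#
⟦ Sign.- ⟧ = - 1#

ℕ⁺ : Pred ℕ 0ℓ
ℕ⁺ k = 0 ℕ.< k

2ℕ+1 : Pred ℕ 0ℓ
2ℕ+1 k = ∃[ m ] k ≡ 2 ℕ.* m ℕ.+ 1

------------------------------------------------------------------------
-- Linear algebra over a finite index set V; the enumeration only serves
-- to form sums over V and to decide equality in V.

module Spectral {V : Set} {n : ℕ} (enum : Fin n ↔ V) where

  open Inverse enum using (to; from)

  infixl 7 _*ᵥ_ _*ₘ_ _•_
  infixl 6 _-ᵥ_
  infixr 8 _^ₘ_
  infix  4 _≈ᵥ_

  Vect Matrix : Set
  Vect   = V → ℝ
  Matrix = V → V → ℝ

  _≈ᵥ_ : Vect → Vect → Set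
  x ≈ᵥ y = ∀ v → x v ≈ y v

  0ᵥ : Vect
  0ᵥ _ = 0#

  _-ᵥ_ : Vect → Vect → Vect
  (x -ᵥ y) v = x v - y v

  _•_ : ℝ → Vect → Vect
  (c • x) v = c * x v

  e : V → Vect
  e v w = if does (from v Fin.≟ from w) then 1# else 0#

  ∑ : (V → ℝ) → ℝ
  ∑ f = sum λ i → f (to i)

  ⟨_,_⟩ : Vect → Vect → ℝ
  ⟨ x , y ⟩ = ∑ λ v → x v * y v

  _*ᵥ_ : Matrix → Vect → Vect
  (A *ᵥ x) u = ∑ λ v → A u v * x v

  _*ₘ_ : Matrix → Matrix → Matrix
  (A *ₘ B) u w = ∑ λ v → A u v * B v w

  _^ₘ_ : Matrix → ℕ → Matrix
  A ^ₘ zero  = e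
  A ^ₘ suc k = A *ₘ (A ^ₘ k)

  IsSymmetric : Matrix → Set
  IsSymmetric A = ∀ u v → A u v ≈ A v u

  Eigenspace : Matrix → ℝ → Pred Vect 0ℓ
  Eigenspace H θ x = H *ᵥ x ≈ᵥ θ • x

  Spec : Matrix → Pred ℝ 0ℓ
  Spec H θ = ∃[ x ] (x ∈ Eigenspace H θ × ¬ (x ≈ᵥ 0ᵥ))

  record IsOrthogonalProjection (E : Matrix) (S : Pred Vect 0ℓ) : Set where
    field
      into       : ∀ x → E *ᵥ x ∈ S
      orthogonal : ∀ x y → y ∈ S → ⟨ x -ᵥ E *ᵥ x , y ⟩ ≈ 0#

  -- IsE H θ E says that E is E_θ.  Such a matrix is unique up to pointwise _≈_, and
  -- classically always exists; so ∃[ E ] (IsE H θ E × P E) expresses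
  -- that E_θ satisfies P.
  IsE : Matrix → ℝ → Matrix → Set
  IsE H θ E = IsOrthogonalProjection E (Eigenspace H θ)

  supp : Matrix → Vect → Pred ℝ 0ℓ
  supp H x θ = θ ∈ Spec H × ∃[ E ] (IsE H θ E × ¬ (E *ᵥ x ≈ᵥ 0ᵥ))

  -- The signs σ_θ are determined by E_θ e_b = σ_θ E_θ e_a, since
  -- E_θ e_a ≠ 0 on the support; in particular they do not depend on the
  -- proof of θ ∈ supp H (e a), nor on the representative of θ up to _≈_.
  record StronglyCospectral (H : Matrix) (a b : V) : Set where
    field
      same-supp : supp H (e a) ≐ supp H (e b)
      σ         : ∀ θ → θ ∈ supp H (e a) → Sign
      σ-spec    : ∀ θ (p : θ ∈ supp H (e a)) →
                  ∃[ E ] (IsE H θ E × E *ᵥ e b ≈ᵥ ⟦ σ θ p ⟧ • (E *ᵥ e a))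

  𝒢 : Matrix → V → V → Pred ℕ 0ℓ
  𝒢 H a b k = k ∈ ℕ⁺ × StronglyCospectral (H ^ₘ k) a b

  SignsAgree : ∀ {H a b} → StronglyCospectral H a b → Set
  SignsAgree {H} {a} sc =
    ∀ ρ (p : ρ ∈ supp H (e a)) (q : - ρ ∈ supp H (e a)) → σ ρ p ≡ σ (- ρ) q
    where open StronglyCospectral sc

{-# OPTIONS --safe #-}

-- Since E_θ is self-adjoint, E_θ e_b = σ E_θ e_a says exactly that y_b = σ y_a for every
-- θ-eigenvector y, and θ lies in the support of e_a when some θ-eigenvector has y_a ≠ 0.  So a
-- and b are strongly cospectral iff every eigenspace has such a sign σ_θ.
--
-- A θ-eigenvector of H is a θᵏ-eigenvector of Hᵏ, so signs for Hᵏ restrict to signs for H; for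
-- even k the ρ- and (−ρ)-eigenspaces even share one.  Conversely let Hᵏ y = μ y with μ ≠ 0, and
-- choose a real θ with θ²ᵏ = μ².  The quotient of H²ᵏ − θ²ᵏ by H² − θ² is positive definite, hence
-- H² y = θ² y.  Then θ y ± H y are eigenvectors for ± θ, which gives a sign for Hᵏ when σ_θ = σ_{−θ};
-- and for odd k = 2m + 1 already H y = (μ / θ²ᵐ) y.  If μ = 0 then H y = 0.
module Submission where

import Algebra.Properties.CommutativeSemiring.Exp as CommutativeExp
import Algebra.Properties.Group as GroupProperties
import Algebra.Properties.Semiring.Exp as Exp
import Algebra.Properties.Semiring.Mult as Mult
import Algebra.Properties.Semiring.Sum as Sum
import Algebra.Definitions.RawMonoid as RawMonoidDefs
import Algebra.Solver.Ring as RingSolver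
import Algebra.Solver.Ring.AlmostCommutativeRing as ACR
open import Algebra.Bundles using (CommutativeRing)
open import Axiom.ExcludedMiddle using (ExcludedMiddle)
open import Data.Bool.Base using (if_then_else_)
open import Data.Fin.Base using (Fin; zero; suc)
import Data.Fin.Properties as Fin
import Data.Integer.Base as ℤ
import Data.Integer.Properties as ℤ
import Data.Maybe.Base as Maybe
open import Data.Nat.Base as ℕ using (ℕ; zero; suc; _≥_; _⊔_)
open import Data.Nat.DivMod using (_divMod_; result)
open import Data.Nat.GeneralisedArithmetic using (fold; fold-+)
import Data.Nat.Properties as ℕ
open import Data.Product.Base using (∃-syntax; _×_; _,_; proj₁; proj₂)
open import Data.Rational.Base as ℚ using (ℚ; mkℚ; 0ℚ; 1ℚ; ½; ∣_∣)
import Data.Rational.Properties as ℚ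
open import Data.Rational.Solver using (module +-*-Solver)
import Data.Rational.Unnormalised.Base as ℚᵘ
import Data.Rational.Unnormalised.Properties as ℚᵘ
open import Data.Sign.Base using (Sign)
open import Data.Sum.Base using (_⊎_; inj₁; inj₂; [_,_]′)
open import Function.Base using (_∘_)
open import Function.Bundles using (_↔_; Inverse)
open import Level using (0ℓ)
open import Relation.Binary.PropositionalEquality as ≡ using (_≡_; _≢_; cong; subst)
import Relation.Binary.Reasoning.Setoid as ≈-Reasoning
open import Relation.Nullary.Decidable using (dec-true; dec-false)
open import Relation.Nullary.Decidable.Core using (Dec; yes; no; dec⇒maybe)
open import Relation.Nullary.Negation.Core using (¬_; contradiction)
open import Relation.Unary using (Pred; _∈_; _∉_; _≐_; ∅)
open import Defs

open CommutativeRing ℝ-commutativeRing hiding (_≉_; zero)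
open CommutativeExp commutativeSemiring using (^-distrib-*)
open Exp semiring
open Sum semiring using (sum; sum-cong-≋; sum-replicate-zero; *-distribˡ-sum; *-distribʳ-sum; ∑-distrib-+; ∑-comm)
open Mult (CommutativeRing.semiring ℚ.+-*-commutativeRing) using (×-assoc-*)
open Estimates using (halve; 0<1; close-scale)

-- Rational numbers

p≤∣p∣ : ∀ p → p ℚ.≤ ∣ p ∣
p≤∣p∣ p with ℚ.≤-total 0ℚ p
... | inj₁ 0≤p = ℚ.≤-reflexive (≡.sym (ℚ.0≤p⇒∣p∣≡p 0≤p))
... | inj₂ p≤0 = ℚ.≤-trans p≤0 (ℚ.0≤∣p∣ p)

∣p∣<q : ∀ {p q} → p ℚ.< q → ℚ.- p ℚ.< q → ∣ p ∣ ℚ.< q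
∣p∣<q {p} p<q -p<q with ℚ.∣p∣≡p∨∣p∣≡-p p
... | inj₁ eq = subst (ℚ._< _) (≡.sym eq) p<q
... | inj₂ eq = subst (ℚ._< _) (≡.sym eq) -p<q

p-q≤r⇒p≤q+r : ∀ p q r → p ℚ.- q ℚ.≤ r → p ℚ.≤ q ℚ.+ r
p-q≤r⇒p≤q+r p q r h = subst (ℚ._≤ q ℚ.+ r)
  (solve 2 (λ p q → q :+ (p :- q) := p) ≡.refl p q) (ℚ.+-monoʳ-≤ q h)
  where open +-*-Solver

p≤q+r⇒p-q≤r : ∀ p q r → p ℚ.≤ q ℚ.+ r → p ℚ.- q ℚ.≤ r
p≤q+r⇒p-q≤r p q r h = subst (p ℚ.- q ℚ.≤_)
  (solve 2 (λ q r → (q :+ r) :- q := r) ≡.refl q r) (ℚ.+-monoˡ-≤ (ℚ.- q) h)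
  where open +-*-Solver

Close⇒≤ : ∀ {ε} p q → Close ε p q → p ℚ.≤ q ℚ.+ ε
Close⇒≤ p q c = p-q≤r⇒p≤q+r p q _ (ℚ.≤-trans (p≤∣p∣ (p ℚ.- q)) (ℚ.<⇒≤ c))

-[p-q] : ∀ p q → ℚ.- (p ℚ.- q) ≡ q ℚ.- p
-[p-q] = solve 2 (λ p q → :- (p :- q) := q :- p) ≡.refl
  where open +-*-Solver

≤⇒Close : ∀ {δ ε} p q → p ℚ.≤ q ℚ.+ δ → q ℚ.≤ p ℚ.+ δ → δ ℚ.< ε → Close ε p q
≤⇒Close p q p≤ q≤ δ<ε = ∣p∣<q
  (ℚ.≤-<-trans (p≤q+r⇒p-q≤r p q _ p≤) δ<ε)
  (ℚ.≤-<-trans (ℚ.≤-reflexive (-[p-q] p q)) (ℚ.≤-<-trans (p≤q+r⇒p-q≤r q p _ q≤) δ<ε))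

p<p+q : ∀ p {q} → 0ℚ ℚ.< q → p ℚ.< p ℚ.+ q
p<p+q p {q} 0<q = subst (ℚ._< p ℚ.+ q) (ℚ.+-identityʳ p) (ℚ.+-monoʳ-< p 0<q)

p≤p+q : ∀ p {q} → 0ℚ ℚ.≤ q → p ℚ.≤ p ℚ.+ q
p≤p+q p {q} 0≤q = subst (ℚ._≤ p ℚ.+ q) (ℚ.+-identityʳ p) (ℚ.+-monoʳ-≤ p 0≤q)

half-< : ∀ {ε} (0<ε : 0ℚ ℚ.< ε) → let δ , 0<δ , _ = halve ε 0<ε in δ ℚ.< ε
half-< {ε} 0<ε = let δ , 0<δ , δ+δ≡ε = halve ε 0<ε in
  subst (δ ℚ.<_) δ+δ≡ε (p<p+q δ 0<δ)

0≤p*p : ∀ p → 0ℚ ℚ.≤ p ℚ.* p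
0≤p*p p with ℚ.≤-total 0ℚ p
... | inj₁ 0≤p = ℚ.nonNegative⁻¹ _
      {{ℚ.nonNeg*nonNeg⇒nonNeg p {{ℚ.nonNegative 0≤p}} p {{ℚ.nonNegative 0≤p}}}}
... | inj₂ p≤0 = ℚ.nonNegative⁻¹ _
      {{ℚ.nonPos*nonPos⇒nonPos p {{ℚ.nonPositive p≤0}} p {{ℚ.nonPositive p≤0}}}}

-- Archimedean property and repeated halving of rationals.

open RawMonoidDefs ℚ.+-0-rawMonoid using () renaming (_×_ to _ℚ×_)

toℚᵘ-×1 : ∀ n → ℚ.toℚᵘ (n ℚ× 1ℚ) ℚᵘ.≃ ℚᵘ.mkℚᵘ (ℤ.+ n) 0
toℚᵘ-×1 zero    = ℚᵘ.≃-refl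
toℚᵘ-×1 (suc n) = ℚᵘ.≃-trans (ℚ.toℚᵘ-homo-+ 1ℚ (n ℚ× 1ℚ))
  (ℚᵘ.≃-trans (ℚᵘ.+-congʳ ℚᵘ.1ℚᵘ (toℚᵘ-×1 n))
  (ℚᵘ.*≡* (cong (ℤ._* ℤ.1ℤ) (cong (λ i → ℤ.1ℤ ℤ.+ i) (ℤ.*-identityʳ (ℤ.+ n))))))

i≤+∣i∣ : ∀ i → i ℤ.≤ ℤ.+ ℤ.∣ i ∣
i≤+∣i∣ (ℤ.+ n)    = ℤ.≤-refl
i≤+∣i∣ ℤ.-[1+ n ] = ℤ.-≤+

-- The absolute value of the numerator serves as n, since the denominator is at least 1; in
-- unnormalised fractions the claim is an inequality of integers.
p≤n×1 : ∀ p → ∃[ n ] p ℚ.≤ n ℚ× 1ℚ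
p≤n×1 p@(mkℚ i d _) = ℤ.∣ i ∣ , ℚ.toℚᵘ-cancel-≤ (ℚᵘ.≤-trans
  (ℚᵘ.*≤* (ℤ.≤-trans (ℤ.≤-reflexive (ℤ.*-identityʳ i)) (ℤ.≤-trans (i≤+∣i∣ i)
    (ℤ.≤-trans (ℤ.+≤+ (ℕ.m≤m*n ℤ.∣ i ∣ (suc d))) (ℤ.≤-reflexive (ℤ.pos-* ℤ.∣ i ∣ (suc d)))))))
  (ℚᵘ.≤-reflexive (ℚᵘ.≃-sym (toℚᵘ-×1 ℤ.∣ i ∣))))

×1-* : ∀ n p → (n ℚ× 1ℚ) ℚ.* p ≡ n ℚ× p
×1-* n p = ≡.trans (×-assoc-* n 1ℚ p) (cong (n ℚ×_) (ℚ.*-identityˡ p))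

archimedean : ∀ p {ε} → 0ℚ ℚ.< ε → ∃[ n ] p ℚ.≤ n ℚ× ε
archimedean p {ε} 0<ε =
  let n , h = p≤n×1 (p ℚ.* 1/ε)
  in n , ≡.subst₂ ℚ._≤_
       (≡.trans (ℚ.*-assoc p 1/ε ε) (≡.trans (cong (p ℚ.*_) (ℚ.*-inverseˡ ε)) (ℚ.*-identityʳ p)))
       (×1-* n ε)
       (ℚ.*-monoʳ-≤-nonNeg ε h)
  where
  instance
    _ = ℚ.pos⇒nonZero ε {{ℚ.positive 0<ε}}
    _ = ℚ.pos⇒nonNeg ε {{ℚ.positive 0<ε}}
  1/ε = ℚ.1/ ε

0≤n× : ∀ n {p} → 0ℚ ℚ.≤ p → 0ℚ ℚ.≤ n ℚ× p
0≤n× zero    0≤p = ℚ.≤-refl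
0≤n× (suc n) 0≤p = ℚ.+-mono-≤ 0≤p (0≤n× n 0≤p)

-- The quotient p / 2ⁿ, with the halving done before the recursive call to match the recursion of
-- `bracket`.
halves : ℕ → ℚ → ℚ
halves zero    p = p
halves (suc n) p = halves n (½ ℚ.* p)

-- Half of n + 2 copies of ε is at most n + 1 copies, so each halving uses up at least one copy
-- until a single one is left.
halves-≤ : ∀ n p {ε} → 0ℚ ℚ.≤ ε → p ℚ.≤ suc n ℚ× ε → halves n p ℚ.≤ ε
halves-≤ zero    p {ε} 0≤ε h = ℚ.≤-trans h (ℚ.≤-reflexive (ℚ.+-identityʳ ε))
halves-≤ (suc n) p {ε} 0≤ε h = halves-≤ n (½ ℚ.* p) 0≤ε (begin
  ½ ℚ.* p                              ≤⟨ ℚ.*-monoˡ-≤-nonNeg ½ h ⟩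
  ½ ℚ.* (ε ℚ.+ (ε ℚ.+ q))              ≤⟨ p≤p+q _ (ℚ.*-monoˡ-≤-nonNeg ½ (0≤n× n 0≤ε)) ⟩
  ½ ℚ.* (ε ℚ.+ (ε ℚ.+ q)) ℚ.+ ½ ℚ.* q  ≡⟨ solve 2 (λ e q → con ½ :* (e :+ (e :+ q)) :+ con ½ :* q := e :+ q) ≡.refl ε q ⟩
  ε ℚ.+ q                              ∎)
  where
  open ℚ.≤-Reasoning
  open +-*-Solver
  q = n ℚ× ε

-- Order on ℝ

infix 4 _≤_

-- The slack ε makes the relation invariant under adding null sequences, hence compatible with
-- `_≈_`.
record _≤_ (x y : ℝ) : Set where
  constructor mk≤
  field
    below : ∀ ε → 0ℚ ℚ.< ε → ∃[ N ] (∀ n → n ≥ N → seq x n ℚ.≤ seq y n ℚ.+ ε)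

open _≤_

≈⇒≤ : ∀ {x y} → x ≈ y → x ≤ y
≈⇒≤ {x} {y} x≈y = mk≤ λ ε 0<ε → let N , f = close x≈y ε 0<ε in
  N , λ n n≥N → Close⇒≤ (seq x n) (seq y n) (f n n≥N)

≤-trans : ∀ {x y z} → x ≤ y → y ≤ z → x ≤ z
≤-trans {x} {y} {z} x≤y y≤z = mk≤ λ ε 0<ε →
  let δ , 0<δ , δ+δ≡ε = halve ε 0<ε
      M , f = below x≤y δ 0<δ
      N , g = below y≤z δ 0<δ
  in M ⊔ N , λ n n≥ → begin
       seq x n                        ≤⟨ f n (ℕ.m⊔n≤o⇒m≤o M N n≥) ⟩
       seq y n ℚ.+ δ                  ≤⟨ ℚ.+-monoˡ-≤ δ (g n (ℕ.m⊔n≤o⇒n≤o M N n≥)) ⟩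
       seq z n ℚ.+ δ ℚ.+ δ            ≡⟨ ℚ.+-assoc (seq z n) δ δ ⟩
       seq z n ℚ.+ (δ ℚ.+ δ)          ≡⟨ cong (seq z n ℚ.+_) δ+δ≡ε ⟩
       seq z n ℚ.+ ε                  ∎
  where open ℚ.≤-Reasoning

≤-respˡ-≈ : ∀ {x y z} → x ≈ y → x ≤ z → y ≤ z
≤-respˡ-≈ x≈y = ≤-trans (≈⇒≤ (sym x≈y))

≤-respʳ-≈ : ∀ {x y z} → y ≈ z → x ≤ y → x ≤ z
≤-respʳ-≈ y≈z x≤y = ≤-trans x≤y (≈⇒≤ y≈z)

≤-antisym : ∀ {x y} → x ≤ y → y ≤ x → x ≈ y
≤-antisym {x} {y} x≤y y≤x = mk≈ λ ε 0<ε →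
  let δ , 0<δ , _ = halve ε 0<ε
      M , f = below x≤y δ 0<δ
      N , g = below y≤x δ 0<δ
  in M ⊔ N , λ n n≥ → ≤⇒Close (seq x n) (seq y n)
       (f n (ℕ.m⊔n≤o⇒m≤o M N n≥)) (g n (ℕ.m⊔n≤o⇒n≤o M N n≥)) (half-< 0<ε)

-- The bound on the n-th term holds only from an index depending on n onwards. It is read at a late
-- index j, and the Cauchy property of y carries it back from j to n.
lim-≤ : ∀ x {y} → (∀ n → fromℚ (seq x n) ≤ y) → x ≤ y
lim-≤ x {y} xₙ≤y = mk≤ λ ε 0<ε →
  let δ , 0<δ , δ+δ≡ε = halve ε 0<ε
      M , f = cauchy y δ 0<δ
  in M , λ n n≥M →
       let N , g = below (xₙ≤y n) δ 0<δ
           j = M ⊔ N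
       in begin
       seq x n                        ≤⟨ g j (ℕ.m≤n⊔m M N) ⟩
       seq y j ℚ.+ δ                  ≤⟨ ℚ.+-monoˡ-≤ δ (Close⇒≤ (seq y j) (seq y n) (f j n (ℕ.m≤m⊔n M N) n≥M)) ⟩
       seq y n ℚ.+ δ ℚ.+ δ            ≡⟨ ℚ.+-assoc (seq y n) δ δ ⟩
       seq y n ℚ.+ (δ ℚ.+ δ)          ≡⟨ cong (seq y n ℚ.+_) δ+δ≡ε ⟩
       seq y n ℚ.+ ε                  ∎
  where open ℚ.≤-Reasoning

lim-≥ : ∀ x {y} → (∀ n → y ≤ fromℚ (seq x n)) → y ≤ x
lim-≥ x {y} y≤xₙ = mk≤ λ ε 0<ε →
  let δ , 0<δ , δ+δ≡ε = halve ε 0<ε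
      M , f = cauchy y δ 0<δ
  in M , λ n n≥M →
       let N , g = below (y≤xₙ n) δ 0<δ
           j = M ⊔ N
       in begin
       seq y n                        ≤⟨ Close⇒≤ (seq y n) (seq y j) (f n j n≥M (ℕ.m≤m⊔n M N)) ⟩
       seq y j ℚ.+ δ                  ≤⟨ ℚ.+-monoˡ-≤ δ (g j (ℕ.m≤n⊔m M N)) ⟩
       seq x n ℚ.+ δ ℚ.+ δ            ≡⟨ ℚ.+-assoc (seq x n) δ δ ⟩
       seq x n ℚ.+ (δ ℚ.+ δ)          ≡⟨ cong (seq x n ℚ.+_) δ+δ≡ε ⟩
       seq x n ℚ.+ ε                  ∎
  where open ℚ.≤-Reasoning

-- Order and ring operations, and the embedding of the rationals.

opaque
  unfolding _+ᴿ_ -ᴿ_ _*ᴿ_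

  +-monoʳ-≤ : ∀ z {x y} → x ≤ y → z + x ≤ z + y
  +-monoʳ-≤ z {x} {y} x≤y = mk≤ λ ε 0<ε → let N , f = below x≤y ε 0<ε in
    N , λ n n≥N → ℚ.≤-trans (ℚ.+-monoʳ-≤ (seq z n) (f n n≥N))
                    (ℚ.≤-reflexive (≡.sym (ℚ.+-assoc (seq z n) (seq y n) ε)))

  0≤x*x : ∀ x → 0# ≤ x * x
  0≤x*x x = mk≤ λ ε 0<ε → 0 , λ n _ →
    ℚ.≤-trans (0≤p*p (seq x n)) (p≤p+q _ (ℚ.<⇒≤ 0<ε))

  -- Exported because products no longer compute termwise outside this block.
  seq-* : ∀ x y n → seq (x * y) n ≡ seq x n ℚ.* seq y n
  seq-* x y n = ≡.refl

  fromℚ-+ : ∀ p q → fromℚ (p ℚ.+ q) ≈ fromℚ p + fromℚ q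
  fromℚ-+ p q = Estimates.pointwise _ _ λ _ → ≡.refl

  fromℚ-* : ∀ p q → fromℚ (p ℚ.* q) ≈ fromℚ p * fromℚ q
  fromℚ-* p q = Estimates.pointwise _ _ λ _ → ≡.refl

  fromℚ-neg : ∀ p → fromℚ (ℚ.- p) ≈ - fromℚ p
  fromℚ-neg p = Estimates.pointwise _ _ λ _ → ≡.refl

fromℚ-morphism : CommutativeRing.rawRing ℚ.+-*-commutativeRing
                 ACR.-Raw-AlmostCommutative⟶ ACR.fromCommutativeRing ℝ-commutativeRing
fromℚ-morphism = record
  { ⟦_⟧    = fromℚ
  ; +-homo = fromℚ-+
  ; *-homo = fromℚ-*
  ; -‿homo = fromℚ-neg
  ; 0-homo = refl
  ; 1-homo = refl
  }

-- Rational coefficients have decidable equality, which the normaliser uses, and they admit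
-- constants such as ½ in identities over ℝ.
module ℝ-Solver = RingSolver
  (CommutativeRing.rawRing ℚ.+-*-commutativeRing)
  (ACR.fromCommutativeRing ℝ-commutativeRing)
  fromℚ-morphism
  (λ p q → Maybe.map (λ p≡q → reflexive (cong fromℚ p≡q)) (dec⇒maybe (p ℚ.≟ q)))

0≤x+y : ∀ {x y} → 0# ≤ x → 0# ≤ y → 0# ≤ x + y
0≤x+y {x} 0≤x 0≤y = ≤-trans 0≤x (≤-respˡ-≈ (+-identityʳ x) (+-monoʳ-≤ x 0≤y))

x+y≈0⇒x≈0 : ∀ {x y} → 0# ≤ x → 0# ≤ y → x + y ≈ 0# → x ≈ 0#
x+y≈0⇒x≈0 {x} 0≤x 0≤y x+y≈0 = ≤-antisym
  (≤-respʳ-≈ x+y≈0 (≤-respˡ-≈ (+-identityʳ x) (+-monoʳ-≤ x 0≤y))) 0≤x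

-- Bisection

-- `L` and `U` together cover ℚ and may overlap. Each bracket keeps `L` at its left end and `U` at
-- its right end, whichever alternative `choose` returns at the midpoint.
module Bisection {L U : ℚ → Set} (choose : ∀ q → L q ⊎ U q) where

  record Bracket : Set where
    field
      lo hi : ℚ
      lo≤hi : lo ℚ.≤ hi
      L-lo  : L lo
      U-hi  : U hi

  open Bracket

  width : Bracket → ℚ
  width b = hi b ℚ.- lo b

  infix 4 _⊑_
  _⊑_ : Bracket → Bracket → Set
  b ⊑ c = lo c ℚ.≤ lo b × hi b ℚ.≤ hi c

  private
    mid : Bracket → ℚ
    mid b = ½ ℚ.* (lo b ℚ.+ hi b)

    lo≤mid : ∀ b → lo b ℚ.≤ mid b
    lo≤mid b = begin
      lo b                    ≡⟨ solve 1 (λ l → l := con ½ :* (l :+ l)) ≡.refl (lo b) ⟩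
      ½ ℚ.* (lo b ℚ.+ lo b)   ≤⟨ ℚ.*-monoˡ-≤-nonNeg ½ (ℚ.+-monoʳ-≤ (lo b) (lo≤hi b)) ⟩
      mid b                   ∎
      where
      open ℚ.≤-Reasoning
      open +-*-Solver

    mid≤hi : ∀ b → mid b ℚ.≤ hi b
    mid≤hi b = begin
      mid b                   ≤⟨ ℚ.*-monoˡ-≤-nonNeg ½ (ℚ.+-monoˡ-≤ (hi b) (lo≤hi b)) ⟩
      ½ ℚ.* (hi b ℚ.+ hi b)   ≡⟨ solve 1 (λ h → con ½ :* (h :+ h) := h) ≡.refl (hi b) ⟩
      hi b                    ∎
      where
      open ℚ.≤-Reasoning
      open +-*-Solver

  bisect : ∀ b → ∃[ c ] (c ⊑ b × width c ≡ ½ ℚ.* width b)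
  bisect b with choose (mid b)
  ... | inj₁ l = record { Bracket b ; lo = mid b ; lo≤hi = mid≤hi b ; L-lo = l }
               , (lo≤mid b , ℚ.≤-refl)
               , solve 2 (λ l h → h :- con ½ :* (l :+ h) := con ½ :* (h :- l)) ≡.refl (lo b) (hi b)
    where open +-*-Solver
  ... | inj₂ u = record { Bracket b ; hi = mid b ; lo≤hi = lo≤mid b ; U-hi = u }
               , (ℚ.≤-refl , mid≤hi b)
               , solve 2 (λ l h → con ½ :* (l :+ h) :- l := con ½ :* (h :- l)) ≡.refl (lo b) (hi b)
    where open +-*-Solver

  bracket : Bracket → ℕ → Bracket
  bracket b zero    = b
  bracket b (suc n) = bracket (proj₁ (bisect b)) n

  width-bracket : ∀ b n → width (bracket b n) ≡ halves n (width b)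
  width-bracket b zero    = ≡.refl
  width-bracket b (suc n) = let c , _ , eq = bisect b in
    ≡.trans (width-bracket c n) (cong (halves n) eq)

  bracket-⊑ : ∀ b n → bracket b n ⊑ b
  bracket-⊑ b zero    = ℚ.≤-refl , ℚ.≤-refl
  bracket-⊑ b (suc n) =
    let c , (l , h) , _ = bisect b
        l′ , h′ = bracket-⊑ c n
    in ℚ.≤-trans l l′ , ℚ.≤-trans h′ h

  bracket-mono : ∀ b {m n} → n ≥ m → bracket b n ⊑ bracket b m
  bracket-mono b {n = n}     ℕ.z≤n       = bracket-⊑ b n
  bracket-mono b {m = suc _} (ℕ.s≤s n≥m) = bracket-mono (proj₁ (bisect b)) n≥m

  narrow : ∀ b ε → 0ℚ ℚ.< ε → ∃[ N ] width (bracket b N) ℚ.< ε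
  narrow b ε 0<ε =
    let δ , 0<δ , _ = halve ε 0<ε
        n , h = archimedean (width b) 0<δ
    in n , ℚ.≤-<-trans
         (ℚ.≤-trans (ℚ.≤-reflexive (width-bracket b n))
           (halves-≤ n (width b) (ℚ.<⇒≤ 0<δ)
             -- `halves-≤` expects `suc n` copies of δ while `archimedean` gives n, so one copy is
             -- added.
             (ℚ.≤-trans h (ℚ.≤-trans (ℚ.≤-reflexive (≡.sym (ℚ.+-identityˡ _))) (ℚ.+-monoˡ-≤ _ (ℚ.<⇒≤ 0<δ))))))
         (half-< 0<ε)

  between : ∀ b {p q} → lo b ℚ.≤ p → p ℚ.≤ hi b → lo b ℚ.≤ q → q ℚ.≤ hi b →
            ∀ {ε} → width b ℚ.< ε → Close ε p q
  between b {p} {q} l≤p p≤h l≤q q≤h = ≤⇒Close p q (bound l≤q p≤h) (bound l≤p q≤h)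
    where
    bound : ∀ {r s} → lo b ℚ.≤ r → s ℚ.≤ hi b → s ℚ.≤ r ℚ.+ width b
    bound {r} {s} l≤r s≤h = ℚ.≤-trans s≤h (ℚ.≤-trans
      (ℚ.≤-reflexive (solve 2 (λ l h → h := l :+ (h :- l)) ≡.refl (lo b) (hi b)))
      (ℚ.+-monoˡ-≤ (width b) l≤r))
      where open +-*-Solver

  module _ (b : Bracket) where
    private
      c = bracket b

    lower : ℝ
    lower = mkℝ (λ n → lo (c n)) λ ε 0<ε → let N , w = narrow b ε 0<ε in
      N , λ m n m≥N n≥N →
        let lm , hm = bracket-mono b m≥N ; ln , hn = bracket-mono b n≥N
        in between (c N) lm (ℚ.≤-trans (lo≤hi (c m)) hm) ln (ℚ.≤-trans (lo≤hi (c n)) hn) w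

    upper : ℝ
    upper = mkℝ (λ n → hi (c n)) λ ε 0<ε → let N , w = narrow b ε 0<ε in
      N , λ m n m≥N n≥N →
        let lm , hm = bracket-mono b m≥N ; ln , hn = bracket-mono b n≥N
        in between (c N) (ℚ.≤-trans lm (lo≤hi (c m))) hm (ℚ.≤-trans ln (lo≤hi (c n))) hn w

    -- One real with two representatives: the terms of `lower` all satisfy `L` and those of `upper`
    -- all satisfy `U`, so the limit inherits both bounds.
    lower≈upper : lower ≈ upper
    lower≈upper = mk≈ λ ε 0<ε → let N , w = narrow b ε 0<ε in
      N , λ n n≥N →
        let ln , hn = bracket-mono b n≥N
        in between (c N) ln (ℚ.≤-trans (lo≤hi (c n)) hn) (ℚ.≤-trans ln (lo≤hi (c n))) hn w

    lower-L : ∀ n → L (seq lower n)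
    lower-L n = L-lo (c n)

    upper-U : ∀ n → U (seq upper n)
    upper-U n = U-hi (c n)

-- Lets bounds on powers of the rational terms of x be read as bounds on the terms of `x ^ k`, as
-- `lim-≤` and `lim-≥` require.
fromℚ-^ : ∀ x k n → fromℚ (seq x n) ^ k ≈ fromℚ (seq (x ^ k) n)
fromℚ-^ x zero    n = refl
fromℚ-^ x (suc k) n = trans (*-congˡ (fromℚ-^ x k n))
  (trans (sym (fromℚ-* (seq x n) (seq (x ^ k) n)))
         (reflexive (cong fromℚ (≡.sym (seq-* x (x ^ k) n)))))

module _ {p} (1≤p : 1ℚ ℚ.≤ p) where
  1≤p^k : ∀ k n → 1ℚ ℚ.≤ seq (fromℚ p ^ k) n
  p≤p^1+k : ∀ k n → p ℚ.≤ seq (fromℚ p ^ suc k) n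

  1≤p^k zero    n = ℚ.≤-refl
  1≤p^k (suc k) n = ℚ.≤-trans 1≤p (p≤p^1+k k n)

  p≤p^1+k k n = begin
    p                                ≡⟨ ℚ.*-identityʳ p ⟨
    p ℚ.* 1ℚ                         ≤⟨ ℚ.*-monoˡ-≤-nonNeg p {{ℚ.nonNegative (ℚ.≤-trans (ℚ.<⇒≤ 0<1) 1≤p)}} (1≤p^k k n) ⟩
    p ℚ.* seq (fromℚ p ^ k) n        ≡⟨ seq-* (fromℚ p) (fromℚ p ^ k) n ⟨
    seq (fromℚ p ^ suc k) n          ∎
    where open ℚ.≤-Reasoning

1≉0 : ¬ 1# ≈ 0#
1≉0 1≈0 = let N , f = close 1≈0 1ℚ 0<1 in ℚ.<-irrefl ≡.refl (f N ℕ.≤-refl)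

-- Total order, roots and inverses of reals under excluded middle.

module Classical (em : ExcludedMiddle 0ℓ) where

  ¬¬-elim : ∀ {P : Set} → ¬ ¬ P → P
  ¬¬-elim {P} ¬¬p with em {P}
  ... | yes p = p
  ... | no ¬p = contradiction ¬p ¬¬p

  -- For each ε, comparing both sequences at one late index yields x ≤ y + ε or y ≤ x + ε
  -- eventually. If the latter fails for some ε, it fails for all smaller slacks, so comparing at
  -- the smaller of η and ε gives x ≤ y + η for every η.
  ≤-total : ∀ x y → x ≤ y ⊎ y ≤ x
  ≤-total x y with em {x ≤ y}
  ... | yes x≤y = inj₁ x≤y
  ... | no  x≰y = inj₂ (mk≤ λ ε 0<ε → ¬¬-elim λ ¬B → x≰y (mk≤ λ η 0<η →
      [ (λ η≤ε → [ (λ A → A) , (λ B → contradiction (weaken y x η≤ε B) ¬B) ]′ (compare η 0<η))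
      , (λ ε≤η → [ weaken x y ε≤η , (λ B → contradiction B ¬B) ]′ (compare ε 0<ε))
      ]′ (ℚ.≤-total η ε)))
    where
    Below : ℝ → ℝ → ℚ → Set
    Below x y ε = ∃[ N ] (∀ n → n ≥ N → seq x n ℚ.≤ seq y n ℚ.+ ε)

    weaken : ∀ x y {δ ε} → δ ℚ.≤ ε → Below x y δ → Below x y ε
    weaken x y δ≤ε (N , f) = N , λ n n≥N → ℚ.≤-trans (f n n≥N) (ℚ.+-monoʳ-≤ (seq y n) δ≤ε)

    ordered : ∀ x y {δ ε} N → (∀ m n → m ≥ N → n ≥ N → Close δ (seq x m) (seq x n)) →
              (∀ m n → m ≥ N → n ≥ N → Close δ (seq y m) (seq y n)) →
              δ ℚ.+ δ ≡ ε → seq x N ℚ.≤ seq y N → Below x y ε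
    ordered x y {δ} {ε} N f g δ+δ≡ε xN≤yN = N , λ n n≥N → begin
      seq x n                        ≤⟨ Close⇒≤ (seq x n) (seq x N) (f n N n≥N ℕ.≤-refl) ⟩
      seq x N ℚ.+ δ                  ≤⟨ ℚ.+-monoˡ-≤ δ xN≤yN ⟩
      seq y N ℚ.+ δ                  ≤⟨ ℚ.+-monoˡ-≤ δ (Close⇒≤ (seq y N) (seq y n) (g N n ℕ.≤-refl n≥N)) ⟩
      seq y n ℚ.+ δ ℚ.+ δ            ≡⟨ ℚ.+-assoc (seq y n) δ δ ⟩
      seq y n ℚ.+ (δ ℚ.+ δ)          ≡⟨ cong (seq y n ℚ.+_) δ+δ≡ε ⟩
      seq y n ℚ.+ ε                  ∎
      where open ℚ.≤-Reasoning

    compare : ∀ ε → 0ℚ ℚ.< ε → Below x y ε ⊎ Below y x ε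
    compare ε 0<ε =
      let δ , 0<δ , δ+δ≡ε = halve ε 0<ε
          M , f = cauchy x δ 0<δ
          N , g = cauchy y δ 0<δ
          K = M ⊔ N
          f′ = λ m n m≥ n≥ → f m n (ℕ.m⊔n≤o⇒m≤o M N m≥) (ℕ.m⊔n≤o⇒m≤o M N n≥)
          g′ = λ m n m≥ n≥ → g m n (ℕ.m⊔n≤o⇒n≤o M N m≥) (ℕ.m⊔n≤o⇒n≤o M N n≥)
      in [ (λ le → inj₁ (ordered x y K f′ g′ δ+δ≡ε le))
         , (λ ge → inj₂ (ordered y x K g′ f′ δ+δ≡ε ge)) ]′ (ℚ.≤-total (seq x K) (seq y K))

  private
    bounded-above : ∀ k x → ∃[ p ] (1ℚ ℚ.≤ p × x ≤ fromℚ p ^ suc k)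
    bounded-above k x =
      let B , 0<B , N , bd = Estimates.bounded x
          B≤ = ℚ.≤-trans (ℚ.≤-reflexive (≡.sym (ℚ.+-identityˡ B))) (ℚ.+-monoˡ-≤ B (ℚ.<⇒≤ 0<1))
          1≤ = p≤p+q 1ℚ (ℚ.<⇒≤ 0<B)
      -- With B an eventual bound of ∣x∣, the number 1 + B is at least 1, so its positive powers
      -- dominate it and hence x.
      in 1ℚ ℚ.+ B , 1≤ , mk≤ λ ε 0<ε → N , λ n n≥N →
           ℚ.≤-trans (p≤∣p∣ (seq x n)) (ℚ.≤-trans (bd n n≥N) (ℚ.≤-trans B≤
             (ℚ.≤-trans (p≤p^1+k 1≤ k n) (p≤p+q _ (ℚ.<⇒≤ 0<ε)))))

  -- Bisection between the conditions qᵏ⁺¹ ≤ x and x ≤ qᵏ⁺¹. The bounds pass to the limit because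
  -- powers of reals are formed termwise.
  root : ∀ k {x} → 0# ≤ x → ∃[ r ] r ^ suc k ≈ x
  root k {x} 0≤x = bracketed (bounded-above k x)
    where
    f : ℝ → ℝ
    f = _^ suc k

    open Bisection {λ q → f (fromℚ q) ≤ x} {λ q → x ≤ f (fromℚ q)} (λ q → ≤-total (f (fromℚ q)) x)

    bracketed : ∃[ p ] (1ℚ ℚ.≤ p × x ≤ f (fromℚ p)) → ∃[ r ] f r ≈ x
    bracketed (p , 1≤p , x≤fp) = lower b , ≤-antisym
      (lim-≤ (f (lower b)) λ n → ≤-respˡ-≈ (fromℚ-^ (lower b) (suc k) n) (lower-L b n))
      (≤-respʳ-≈ (sym (^-congˡ (suc k) (lower≈upper b)))
        (lim-≥ (f (upper b)) λ n → ≤-respʳ-≈ (fromℚ-^ (upper b) (suc k) n) (upper-U b n)))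
      where
      b : Bracket
      -- The left end 0 qualifies because its positive powers are 0 and 0 ≤ x.
      b = record { lo = 0ℚ ; hi = p ; lo≤hi = ℚ.≤-trans (ℚ.<⇒≤ 0<1) 1≤p
                 ; L-lo = ≤-respˡ-≈ (sym (zeroˡ _)) 0≤x ; U-hi = x≤fp }

  -- With square roots r of x and s of y, the product is the square of `r * s`.
  0≤x*y : ∀ {x y} → 0# ≤ x → 0# ≤ y → 0# ≤ x * y
  0≤x*y {x} {y} 0≤x 0≤y =
    let r , r²≈x = root 1 0≤x
        s , s²≈y = root 1 0≤y
    in ≤-respʳ-≈
         (trans (solve 2 (λ r s → (r :* s) :* (r :* s) := (r :* (r :* con 1ℚ)) :* (s :* (s :* con 1ℚ))) refl r s)
                (*-cong r²≈x s²≈y))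
         (0≤x*x (r * s))
    where open ℝ-Solver

  -- Suppose x is never bounded away from 0. Take δ = ε / 2, η = ε / 4 and a Cauchy index N for η.
  -- If ∣x_N∣ were at least δ, all later terms would have modulus at least η; so ∣x_N∣ < δ, and all
  -- later terms have modulus below η + δ < ε.
  apart : ∀ {x} → ¬ x ≈ 0# → ∃[ ε ] (0ℚ ℚ.< ε × ∃[ N ] (∀ n → n ≥ N → ε ℚ.≤ ∣ seq x n ∣))
  apart {x} x≉0 = ¬¬-elim λ ¬apart → x≉0 (mk≈ λ ε 0<ε →
    let δ , 0<δ , δ+δ≡ε = halve ε 0<ε
        η , 0<η , η+η≡δ = halve δ 0<δ
        N , f = cauchy x η 0<η
        near : ∣ seq x N ∣ ℚ.< δ
        near = ℚ.≰⇒> λ δ≤∣xN∣ → ¬apart (η , 0<η , N , λ n n≥N →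
          ≤-cancel η (≡.subst₂ ℚ._≤_ (≡.sym η+η≡δ) (ℚ.+-comm η _)
            (ℚ.≤-trans δ≤∣xN∣ (∣∣-shift (f N n ℕ.≤-refl n≥N)))))
    in N , λ n n≥N → subst (ℚ._< ε) (cong ∣_∣ (≡.sym (ℚ.+-identityʳ (seq x n))))
         (ℚ.≤-<-trans (∣∣-shift (f n N n≥N ℕ.≤-refl))
           (subst ((η ℚ.+ ∣ seq x N ∣) ℚ.<_) δ+δ≡ε
             (ℚ.+-mono-< (subst (η ℚ.<_) η+η≡δ (p<p+q η 0<η)) near))))
    where
    ≤-cancel : ∀ r {p q} → r ℚ.+ p ℚ.≤ q ℚ.+ r → p ℚ.≤ q
    ≤-cancel r {p} {q} h = ≡.subst₂ ℚ._≤_ (solve 2 (λ r p → :- r :+ (r :+ p) := p) ≡.refl r p)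
      (solve 2 (λ r q → :- r :+ (q :+ r) := q) ≡.refl r q) (ℚ.+-monoʳ-≤ (ℚ.- r) h)
      where open +-*-Solver

    ∣∣-shift : ∀ {p q δ} → Close δ p q → ∣ p ∣ ℚ.≤ δ ℚ.+ ∣ q ∣
    ∣∣-shift {p} {q} {δ} p~q = begin
      ∣ p ∣                      ≡⟨ cong ∣_∣ (solve 2 (λ p q → p := (p :- q) :+ q) ≡.refl p q) ⟩
      ∣ (p ℚ.- q) ℚ.+ q ∣        ≤⟨ ℚ.∣p+q∣≤∣p∣+∣q∣ (p ℚ.- q) q ⟩
      ∣ p ℚ.- q ∣ ℚ.+ ∣ q ∣      ≤⟨ ℚ.+-monoˡ-≤ ∣ q ∣ (ℚ.<⇒≤ p~q) ⟩
      δ ℚ.+ ∣ q ∣                ∎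
      where
      open ℚ.≤-Reasoning
      open +-*-Solver

  -- Inverts termwise. Beyond the index where ∣xₙ∣ ≥ ε, the identity 1/p - 1/q = (q - p)/(pq) and
  -- the bound ∣1/(pq)∣ ≤ 1/ε² carry the Cauchy property over.
  inverse : ∀ {x} → ¬ x ≈ 0# → ∃[ y ] x * y ≈ 1#
  inverse {x} x≉0 = invert (apart x≉0)
    where
    open +-*-Solver

    inv : ℚ → ℚ
    inv p with p ℚ.≟ 0ℚ
    -- Default value, met by `invert` only at indices below its threshold `N`.
    ... | yes _   = 0ℚ
    ... | no  p≢0 = (ℚ.1/ p) {{ℚ.≢-nonZero p≢0}}

    p*inv : ∀ {p} → p ≢ 0ℚ → p ℚ.* inv p ≡ 1ℚ
    p*inv {p} p≢0 with p ℚ.≟ 0ℚ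
    ... | yes p≡0 = contradiction p≡0 p≢0
    ... | no  ≢0  = ℚ.*-inverseʳ p {{ℚ.≢-nonZero ≢0}}

    inv-diff : ∀ p q i j → p ℚ.* i ≡ 1ℚ → q ℚ.* j ≡ 1ℚ → i ℚ.- j ≡ (i ℚ.* j) ℚ.* (q ℚ.- p)
    inv-diff p q i j pi qj = ≡.sym (≡.trans
      (solve 4 (λ p q i j → (i :* j) :* (q :- p) := i :* (q :* j) :- j :* (p :* i)) ≡.refl p q i j)
      (≡.trans (≡.cong₂ (λ r s → i ℚ.* r ℚ.- j ℚ.* s) qj pi)
        (≡.cong₂ ℚ._-_ (ℚ.*-identityʳ i) (ℚ.*-identityʳ j))))

    invert : ∃[ ε ] (0ℚ ℚ.< ε × ∃[ N ] (∀ n → n ≥ N → ε ℚ.≤ ∣ seq x n ∣)) → ∃[ y ] x * y ≈ 1#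
    invert (ε , 0<ε , N , away) = y , mk≈ λ η 0<η → N , λ n n≥N →
      subst (λ p → Close η p 1ℚ) (≡.sym (≡.trans (seq-* x y n) (p*inv (x≢0 n n≥N))))
            (Estimates.close-refl 1ℚ 0<η)
      where
      instance
        _ = ℚ.pos⇒nonZero ε {{ℚ.positive 0<ε}}
        ε-pos = ℚ.positive 0<ε

      C : ℚ
      C = ℚ.1/ ε

      0<C : 0ℚ ℚ.< C
      0<C = ℚ.positive⁻¹ C {{ℚ.1/pos⇒pos ε}}

      x≢0 : ∀ n → n ≥ N → seq x n ≢ 0ℚ
      x≢0 n n≥N x≡0 = ℚ.<-irrefl ≡.refl
        (ℚ.<-≤-trans 0<ε (subst (ε ℚ.≤_) (cong ∣_∣ x≡0) (away n n≥N)))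

      ∣inv∣≤C : ∀ n → n ≥ N → ∣ inv (seq x n) ∣ ℚ.≤ C
      ∣inv∣≤C n n≥N = ℚ.*-cancelˡ-≤-pos ε (begin
        ε ℚ.* ∣ inv p ∣         ≤⟨ ℚ.*-monoʳ-≤-nonNeg ∣ inv p ∣ {{ℚ.∣-∣-nonNeg (inv p)}} (away n n≥N) ⟩
        ∣ p ∣ ℚ.* ∣ inv p ∣     ≡⟨ ℚ.∣p*q∣≡∣p∣*∣q∣ p (inv p) ⟨
        ∣ p ℚ.* inv p ∣         ≡⟨ cong ∣_∣ (p*inv (x≢0 n n≥N)) ⟩
        1ℚ                      ≡⟨ ℚ.*-inverseʳ ε ⟨
        ε ℚ.* C                 ∎)
        where
        open ℚ.≤-Reasoning
        p = seq x n

      ∣inv*inv∣≤C*C : ∀ m n → m ≥ N → n ≥ N → ∣ inv (seq x m) ℚ.* inv (seq x n) ∣ ℚ.≤ C ℚ.* C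
      ∣inv*inv∣≤C*C m n m≥N n≥N = begin
        ∣ i ℚ.* j ∣         ≡⟨ ℚ.∣p*q∣≡∣p∣*∣q∣ i j ⟩
        ∣ i ∣ ℚ.* ∣ j ∣     ≤⟨ ℚ.*-monoʳ-≤-nonNeg ∣ j ∣ {{ℚ.∣-∣-nonNeg j}} (∣inv∣≤C m m≥N) ⟩
        C ℚ.* ∣ j ∣         ≤⟨ ℚ.*-monoˡ-≤-nonNeg C {{ℚ.nonNegative (ℚ.<⇒≤ 0<C)}} (∣inv∣≤C n n≥N) ⟩
        C ℚ.* C             ∎
        where
        open ℚ.≤-Reasoning
        i = inv (seq x m)
        j = inv (seq x n)

      0<C*C : 0ℚ ℚ.< C ℚ.* C
      0<C*C = ℚ.positive⁻¹ (C ℚ.* C) {{ℚ.pos*pos⇒pos C {{ℚ.1/pos⇒pos ε}} C {{ℚ.1/pos⇒pos ε}}}}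

      y : ℝ
      y = mkℝ (λ n → inv (seq x n)) λ η 0<η →
        let δ , 0<δ , δδ = Estimates.split (C ℚ.* C) η 0<C*C 0<η
            M , f = cauchy x δ 0<δ
            0<CCδ = ℚ.positive⁻¹ (C ℚ.* C ℚ.* δ) {{ℚ.pos*pos⇒pos (C ℚ.* C) {{ℚ.positive 0<C*C}} δ {{ℚ.positive 0<δ}}}}
        in M ⊔ N , λ m n m≥ n≥ →
             let m≥M = ℕ.m⊔n≤o⇒m≤o M N m≥ ; m≥N = ℕ.m⊔n≤o⇒n≤o M N m≥
                 n≥M = ℕ.m⊔n≤o⇒m≤o M N n≥ ; n≥N = ℕ.m⊔n≤o⇒n≤o M N n≥
                 p = seq x m ; q = seq x n
             in subst (λ r → ∣ r ∣ ℚ.< η)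
                  (≡.sym (inv-diff p q (inv p) (inv q) (p*inv (x≢0 m m≥N)) (p*inv (x≢0 n n≥N))))
                  (ℚ.<-trans
                    (close-scale (inv p ℚ.* inv q) (q ℚ.- p) 0<C*C (∣inv*inv∣≤C*C m n m≥N n≥N)
                      (f n m n≥M m≥M))
                    (subst (C ℚ.* C ℚ.* δ ℚ.<_) δδ (p<p+q (C ℚ.* C ℚ.* δ) 0<CCδ)))

  *-cancelˡ : ∀ {x y z} → ¬ x ≈ 0# → x * y ≈ x * z → y ≈ z
  *-cancelˡ {x} {y} {z} x≉0 xy≈xz = let i , xi≈1 = inverse x≉0 in begin
    y             ≈⟨ *-identityˡ y ⟨
    1# * y        ≈⟨ *-congʳ xi≈1 ⟨
    x * i * y     ≈⟨ solve 3 (λ x i y → x :* i :* y := i :* (x :* y)) refl x i y ⟩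
    i * (x * y)   ≈⟨ *-congˡ xy≈xz ⟩
    i * (x * z)   ≈⟨ solve 3 (λ x i y → i :* (x :* y) := x :* i :* y) refl x i z ⟩
    x * i * z     ≈⟨ *-congʳ xi≈1 ⟩
    1# * z        ≈⟨ *-identityˡ z ⟩
    z             ∎
    where
    open ≈-Reasoning setoid
    open ℝ-Solver

  x*y≈0⇒y≈0 : ∀ {x y} → ¬ x ≈ 0# → x * y ≈ 0# → y ≈ 0#
  x*y≈0⇒y≈0 {x} x≉0 xy≈0 = *-cancelˡ x≉0 (trans xy≈0 (sym (zeroʳ x)))

  x*x≈0⇒x≈0 : ∀ {x} → x * x ≈ 0# → x ≈ 0#
  x*x≈0⇒x≈0 xx≈0 = ¬¬-elim λ x≉0 → x≉0 (x*y≈0⇒y≈0 x≉0 xx≈0)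

  x^k≉0 : ∀ {x} k → ¬ x ≈ 0# → ¬ x ^ k ≈ 0#
  x^k≉0 zero    x≉0 1≈0 = 1≉0 1≈0
  x^k≉0 (suc k) x≉0 h   = x^k≉0 k x≉0 (x*y≈0⇒y≈0 x≉0 h)

  x≈-x⇒x≈0 : ∀ {x} → x ≈ - x → x ≈ 0#
  x≈-x⇒x≈0 {x} x≈-x = begin
    x                          ≈⟨ solve 1 (λ x → x := con ½ :* (x :+ x)) refl x ⟩
    fromℚ ½ * (x + x)          ≈⟨ *-congˡ (+-congˡ x≈-x) ⟩
    fromℚ ½ * (x + - x)        ≈⟨ solve 1 (λ x → con ½ :* (x :+ :- x) := con 0ℚ) refl x ⟩
    0#                         ∎
    where
    open ≈-Reasoning setoid
    open ℝ-Solver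

-- Finite sums and iteration

sum-single : ∀ {n} (j : Fin n) (t : Fin n → ℝ) → (∀ i → i ≢ j → t i ≈ 0#) → sum t ≈ t j
sum-single {suc n} zero t t≈0 = trans
  (+-congˡ (trans (sum-cong-≋ λ i → t≈0 (suc i) λ ()) (sum-replicate-zero n)))
  (+-identityʳ (t zero))
sum-single {suc n} (suc j) t t≈0 = trans
  (+-cong (t≈0 zero λ ()) (sum-single j (t ∘ suc) λ i i≢j → t≈0 (suc i) (i≢j ∘ Fin.suc-injective)))
  (+-identityˡ (t (suc j)))

0≤sum : ∀ {n} (t : Fin n → ℝ) → (∀ i → 0# ≤ t i) → 0# ≤ sum t
0≤sum {zero}  t 0≤t = ≈⇒≤ refl
0≤sum {suc n} t 0≤t = 0≤x+y (0≤t zero) (0≤sum (t ∘ suc) (0≤t ∘ suc))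

sum≈0⇒t≈0 : ∀ {n} (t : Fin n → ℝ) → (∀ i → 0# ≤ t i) → sum t ≈ 0# → ∀ i → t i ≈ 0#
sum≈0⇒t≈0 t 0≤t Σ≈0 zero    = x+y≈0⇒x≈0 (0≤t zero) (0≤sum (t ∘ suc) (0≤t ∘ suc)) Σ≈0
sum≈0⇒t≈0 t 0≤t Σ≈0 (suc i) = sum≈0⇒t≈0 (t ∘ suc) (0≤t ∘ suc)
  (x+y≈0⇒x≈0 (0≤sum (t ∘ suc) (0≤t ∘ suc)) (0≤t zero) (trans (+-comm _ _) Σ≈0)) i

fold-comm : ∀ {A : Set} (f : A → A) k x → fold (f x) f k ≡ f (fold x f k)
fold-comm f zero    x = ≡.refl
fold-comm f (suc k) x = cong f (fold-comm f k x)

-- Serves to split H²ᵏ, given as an iterate of H², into Hᵏ applied twice.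
fold-∘ : ∀ {A : Set} (f : A → A) k x → fold x (f ∘ f) k ≡ fold (fold x f k) f k
fold-∘ f zero    x = ≡.refl
fold-∘ f (suc k) x = cong f (≡.trans (cong f (fold-∘ f k x))
  (≡.sym (fold-comm f k (fold x f k))))

even∨odd : ∀ k → (∃[ m ] k ≡ 2 ℕ.* m) ⊎ 2ℕ+1 k
even∨odd k with k divMod 2
... | result q zero       eq = inj₁ (q , ≡.trans eq (ℕ.*-comm q 2))
... | result q (suc zero) eq = inj₂ (q , ≡.trans eq (≡.trans (ℕ.+-comm 1 (q ℕ.* 2)) (cong (ℕ._+ 1) (ℕ.*-comm q 2))))

⟦τ⟧*⟦τ⟧*x≈x : ∀ τ x → ⟦ τ ⟧ * (⟦ τ ⟧ * x) ≈ x
⟦τ⟧*⟦τ⟧*x≈x Sign.+ x = solve 1 (λ x → con 1ℚ :* (con 1ℚ :* x) := x) refl x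
  where open ℝ-Solver
⟦τ⟧*⟦τ⟧*x≈x Sign.- x = solve 1 (λ x → (:- con 1ℚ) :* ((:- con 1ℚ) :* x) := x) refl x
  where open ℝ-Solver

-- Linear algebra over V

module SpectralTheory (em : ExcludedMiddle 0ℓ) {V : Set} {n : ℕ} (enum : Fin n ↔ V) where

  open Classical em
  open Inverse enum using (to; from; strictlyInverseˡ; strictlyInverseʳ)
  open Spectral enum
  open ≈-Reasoning setoid
  open ℝ-Solver using (solve; con; _:+_; _:*_; _:-_; :-_; _:=_)

  ∑-cong : ∀ {f g : V → ℝ} → (∀ v → f v ≈ g v) → ∑ f ≈ ∑ g
  ∑-cong f≈g = sum-cong-≋ (f≈g ∘ to)

  ⟨⟩-cong : ∀ {x x′ y y′} → x ≈ᵥ x′ → y ≈ᵥ y′ → ⟨ x , y ⟩ ≈ ⟨ x′ , y′ ⟩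
  ⟨⟩-cong x≈ y≈ = ∑-cong λ v → *-cong (x≈ v) (y≈ v)

  ⟨⟩-congʳ : ∀ x {y y′} → y ≈ᵥ y′ → ⟨ x , y ⟩ ≈ ⟨ x , y′ ⟩
  ⟨⟩-congʳ x = ⟨⟩-cong {x} {x} λ _ → refl

  ⟨⟩-comm : ∀ x y → ⟨ x , y ⟩ ≈ ⟨ y , x ⟩
  ⟨⟩-comm x y = ∑-cong λ v → *-comm (x v) (y v)

  ⟨⟩-zeroʳ : ∀ x {y} → y ≈ᵥ 0ᵥ → ⟨ x , y ⟩ ≈ 0#
  ⟨⟩-zeroʳ x y≈0 = trans (∑-cong {g = λ _ → 0#} λ v → trans (*-congˡ (y≈0 v)) (zeroʳ (x v))) (sum-replicate-zero n)

  ⟨⟩-zeroˡ : ∀ {x} y → x ≈ᵥ 0ᵥ → ⟨ x , y ⟩ ≈ 0#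
  ⟨⟩-zeroˡ {x} y x≈0 = trans (⟨⟩-comm x y) (⟨⟩-zeroʳ y x≈0)

  ⟨⟩-linʳ : ∀ z {w} c x d y → (∀ v → w v ≈ c * x v + d * y v) →
            ⟨ z , w ⟩ ≈ c * ⟨ z , x ⟩ + d * ⟨ z , y ⟩
  ⟨⟩-linʳ z {w} c x d y w≈ = begin
    ⟨ z , w ⟩
      ≈⟨ ∑-cong (λ v → trans (*-congˡ (w≈ v))
           (solve 5 (λ z c x d y → z :* (c :* x :+ d :* y) := c :* (z :* x) :+ d :* (z :* y)) refl (z v) c (x v) d (y v))) ⟩
    ∑ (λ v → c * (z v * x v) + d * (z v * y v))
      ≈⟨ ∑-distrib-+ (λ i → c * (z (to i) * x (to i))) (λ i → d * (z (to i) * y (to i))) ⟩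
    ∑ (λ v → c * (z v * x v)) + ∑ (λ v → d * (z v * y v))
      ≈⟨ +-cong (*-distribˡ-sum c (λ i → z (to i) * x (to i))) (*-distribˡ-sum d (λ i → z (to i) * y (to i))) ⟨
    c * ⟨ z , x ⟩ + d * ⟨ z , y ⟩ ∎

  ⟨⟩-linˡ : ∀ z {w} c x d y → (∀ v → w v ≈ c * x v + d * y v) →
            ⟨ w , z ⟩ ≈ c * ⟨ x , z ⟩ + d * ⟨ y , z ⟩
  ⟨⟩-linˡ z {w} c x d y w≈ = begin
    ⟨ w , z ⟩                      ≈⟨ ⟨⟩-comm w z ⟩
    ⟨ z , w ⟩                      ≈⟨ ⟨⟩-linʳ z c x d y w≈ ⟩
    c * ⟨ z , x ⟩ + d * ⟨ z , y ⟩  ≈⟨ +-cong (*-congˡ (⟨⟩-comm z x)) (*-congˡ (⟨⟩-comm z y)) ⟩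
    c * ⟨ x , z ⟩ + d * ⟨ y , z ⟩  ∎

  ⟨⟩-minusˡ : ∀ x y z → ⟨ x -ᵥ y , z ⟩ ≈ ⟨ x , z ⟩ - ⟨ y , z ⟩
  ⟨⟩-minusˡ x y z = trans
    (⟨⟩-linˡ z 1# x (- 1#) y λ v → solve 2 (λ x y → x :- y := con 1ℚ :* x :+ (:- con 1ℚ) :* y) refl (x v) (y v))
    (solve 2 (λ x y → con 1ℚ :* x :+ (:- con 1ℚ) :* y := x :- y) refl ⟨ x , z ⟩ ⟨ y , z ⟩)

  ⟨⟩-•ʳ : ∀ z c x → ⟨ z , c • x ⟩ ≈ c * ⟨ z , x ⟩
  ⟨⟩-•ʳ z c x = trans
    (⟨⟩-linʳ z c x 0# x λ v → solve 2 (λ c x → c :* x := c :* x :+ con 0ℚ :* x) refl c (x v))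
    (solve 2 (λ c x → c :* x :+ con 0ℚ :* x := c :* x) refl c ⟨ z , x ⟩)

  0≤⟨x,x⟩ : ∀ x → 0# ≤ ⟨ x , x ⟩
  0≤⟨x,x⟩ x = 0≤sum (λ i → x (to i) * x (to i)) λ i → 0≤x*x (x (to i))

  ⟨x,x⟩≈0⇒x≈0 : ∀ {x} → ⟨ x , x ⟩ ≈ 0# → x ≈ᵥ 0ᵥ
  ⟨x,x⟩≈0⇒x≈0 {x} h v = subst (λ u → x u ≈ 0#) (strictlyInverseˡ v)
    (x*x≈0⇒x≈0 (sum≈0⇒t≈0 (λ i → x (to i) * x (to i)) (λ i → 0≤x*x (x (to i))) h (from v)))

  ⟨e,x⟩ : ∀ u x → ⟨ e u , x ⟩ ≈ x u
  ⟨e,x⟩ u x = begin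
    ⟨ e u , x ⟩            ≈⟨ sum-single (from u) (λ i → e u (to i) * x (to i)) off ⟩
    e u w * x w            ≈⟨ *-congʳ (reflexive (cong (if_then 1# else 0#) (dec-true (from u Fin.≟ from w) (≡.sym (strictlyInverseʳ (from u)))))) ⟩
    1# * x w               ≈⟨ *-identityˡ (x w) ⟩
    x w                    ≡⟨ cong x (strictlyInverseˡ u) ⟩
    x u                    ∎
    where
    w = to (from u)
    off : ∀ i → i ≢ from u → e u (to i) * x (to i) ≈ 0#
    off i i≢ = trans
      (*-congʳ (reflexive (cong (if_then 1# else 0#) (dec-false (from u Fin.≟ from (to i))
        λ eq → i≢ (≡.trans (≡.sym (strictlyInverseʳ i)) (≡.sym eq))))))
      (zeroˡ (x (to i)))

  ⟨x,e⟩ : ∀ u x → ⟨ x , e u ⟩ ≈ x u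
  ⟨x,e⟩ u x = trans (⟨⟩-comm x (e u)) (⟨e,x⟩ u x)

  -- Exchange of the two summations. With x a row of a matrix it shows that products act by
  -- composition; with `A` symmetric it gives self-adjointness.
  ⟨⟩-assoc : ∀ x (A : Matrix) y → ⟨ (λ w → ⟨ x , (λ v → A v w) ⟩) , y ⟩ ≈ ⟨ x , A *ᵥ y ⟩
  ⟨⟩-assoc x A y = begin
    ∑ (λ w → ∑ (λ v → x v * A v w) * y w)
      ≈⟨ ∑-cong (λ w → *-distribʳ-sum (y w) (λ i → x (to i) * A (to i) w)) ⟩
    ∑ (λ w → ∑ (λ v → x v * A v w * y w))
      ≈⟨ ∑-comm (λ i j → x (to j) * A (to j) (to i) * y (to i)) ⟩
    ∑ (λ v → ∑ (λ w → x v * A v w * y w))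
      ≈⟨ ∑-cong (λ v → trans (∑-cong λ w → *-assoc (x v) (A v w) (y w))
           (sym (*-distribˡ-sum (x v) (λ i → A v (to i) * y (to i))))) ⟩
    ⟨ x , A *ᵥ y ⟩ ∎

  *ᵥ-cong : ∀ A {x y} → x ≈ᵥ y → A *ᵥ x ≈ᵥ A *ᵥ y
  *ᵥ-cong A x≈y u = ⟨⟩-congʳ (A u) x≈y

  -- Turns matrix powers into iterates of the linear map, the form in which later arguments handle
  -- them.
  ^ₘ-*ᵥ : ∀ A k x → (A ^ₘ k) *ᵥ x ≈ᵥ fold x (A *ᵥ_) k
  ^ₘ-*ᵥ A zero    x u = ⟨e,x⟩ u x
  ^ₘ-*ᵥ A (suc k) x u = trans (⟨⟩-assoc (A u) (A ^ₘ k) x) (*ᵥ-cong A (^ₘ-*ᵥ A k x) u)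

  *ᵥ-adjoint : ∀ {A} → IsSymmetric A → ∀ x y → ⟨ A *ᵥ x , y ⟩ ≈ ⟨ x , A *ᵥ y ⟩
  *ᵥ-adjoint {A} A-sym x y = trans
    (⟨⟩-cong {A *ᵥ x} {λ w → ⟨ x , (λ v → A v w) ⟩} {y} (λ w → trans (⟨⟩-comm (A w) x) (⟨⟩-congʳ x λ v → A-sym w v)) λ _ → refl)
    (⟨⟩-assoc x A y)

  -- Consequences of being an orthogonal projection.

  module OrthogonalProjection {E : Matrix} {S : Pred Vect 0ℓ} (proj : IsOrthogonalProjection E S) where
    open IsOrthogonalProjection proj public

    ⟨Ex,y⟩≈⟨x,y⟩ : ∀ x y → y ∈ S → ⟨ E *ᵥ x , y ⟩ ≈ ⟨ x , y ⟩
    ⟨Ex,y⟩≈⟨x,y⟩ x y y∈S = sym (x∙y⁻¹≈ε⇒x≈y _ _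
      (trans (sym (⟨⟩-minusˡ x (E *ᵥ x) y)) (orthogonal x y y∈S)))
      where open GroupProperties +-group

    -- Both sides equal ⟨ E x , E y ⟩, because `E *ᵥ x` and `E *ᵥ y` lie in `S`.
    self-adjoint : ∀ x y → ⟨ E *ᵥ x , y ⟩ ≈ ⟨ x , E *ᵥ y ⟩
    self-adjoint x y = begin
      ⟨ E *ᵥ x , y ⟩        ≈⟨ ⟨⟩-comm (E *ᵥ x) y ⟩
      ⟨ y , E *ᵥ x ⟩        ≈⟨ ⟨Ex,y⟩≈⟨x,y⟩ y (E *ᵥ x) (into x) ⟨
      ⟨ E *ᵥ y , E *ᵥ x ⟩   ≈⟨ ⟨⟩-comm (E *ᵥ y) (E *ᵥ x) ⟩
      ⟨ E *ᵥ x , E *ᵥ y ⟩   ≈⟨ ⟨Ex,y⟩≈⟨x,y⟩ x (E *ᵥ y) (into y) ⟩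
      ⟨ x , E *ᵥ y ⟩        ∎

    E-entry : ∀ v w → (E *ᵥ e v) w ≈ (E *ᵥ e w) v
    E-entry v w = begin
      (E *ᵥ e v) w          ≈⟨ ⟨x,e⟩ w (E *ᵥ e v) ⟨
      ⟨ E *ᵥ e v , e w ⟩    ≈⟨ self-adjoint (e v) (e w) ⟩
      ⟨ e v , E *ᵥ e w ⟩    ≈⟨ ⟨e,x⟩ v (E *ᵥ e w) ⟩
      (E *ᵥ e w) v          ∎

    -- The bridge between columns of `E` and entries of vectors in `S`: replacing `e v` by its
    -- projection preserves inner products with `S`.
    y-entry : ∀ v y → y ∈ S → y v ≈ ⟨ E *ᵥ e v , y ⟩
    y-entry v y y∈S = trans (sym (⟨e,x⟩ v y)) (sym (⟨Ex,y⟩≈⟨x,y⟩ (e v) y y∈S))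

  -- Existence of projections onto orthogonal complements and eigenspaces.

  Orthogonal : ∀ {m} → (Fin m → Vect) → Pred Vect 0ℓ
  Orthogonal r y = ∀ i → ⟨ r i , y ⟩ ≈ 0#

  -- The orthogonal complement is cut down one vector r₀ at a time.  If P projects onto the
  -- complement S of the others, then ⟨ r₀ , y ⟩ = ⟨ P r₀ , y ⟩ on S, so removing the component
  -- along u = P r₀ projects onto the vectors of S orthogonal to r₀.
  project : ∀ {m} (r : Fin m → Vect) → ∃[ E ] IsOrthogonalProjection E (Orthogonal r)
  project {zero}  r = e , record
    { into       = λ x ()
    ; orthogonal = λ x y _ → ⟨⟩-zeroˡ y λ v → trans (+-congˡ (-‿cong (⟨e,x⟩ v x))) (-‿inverseʳ (x v))
    }
  project {suc m} r = extend (project (r ∘ suc))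
    where
    r₀ = r zero

    extend : ∃[ P ] IsOrthogonalProjection P (Orthogonal (r ∘ suc)) →
             ∃[ E ] IsOrthogonalProjection E (Orthogonal r)
    extend (P , proj) = cases em
      where
      open OrthogonalProjection proj
      u : Vect
      u = P *ᵥ r₀

      cases : Dec (⟨ u , u ⟩ ≈ 0#) → ∃[ E ] IsOrthogonalProjection E (Orthogonal r)
      -- Here u = 0, so r₀ is already orthogonal to the complement of the other vectors.
      cases (yes uu≈0) = P , record
        { into = λ { x zero → trans (sym (⟨Ex,y⟩≈⟨x,y⟩ r₀ (P *ᵥ x) (into x)))
                                (⟨⟩-zeroˡ {u} (P *ᵥ x) (⟨x,x⟩≈0⇒x≈0 uu≈0))
                   ; x (suc i) → into x i }
        ; orthogonal = λ x y y∈ → orthogonal x y (y∈ ∘ suc)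
        }
      cases (no uu≉0) = E , record { into = into′ ; orthogonal = orthogonal′ }
        where
        c : ℝ
        c = proj₁ (inverse uu≉0)
        uu*c≈1 : ⟨ u , u ⟩ * c ≈ 1#
        uu*c≈1 = proj₂ (inverse uu≉0)

        -- Rank-one correction P - u uᵀ / ⟨ u , u ⟩.
        E : Matrix
        E v w = P v w - c * u v * u w

        Ex : ∀ x v → (E *ᵥ x) v ≈ 1# * (P *ᵥ x) v + (- (c * ⟨ u , x ⟩)) * u v
        Ex x v = trans
          (⟨⟩-linˡ x 1# (P v) (- (c * u v)) u λ w →
            solve 3 (λ p k q → p :- k :* q := con 1ℚ :* p :+ (:- k) :* q) refl (P v w) (c * u v) (u w))
          (+-congˡ (solve 3 (λ c q k → (:- (c :* q)) :* k := (:- (c :* k)) :* q) refl c (u v) ⟨ u , x ⟩))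

        ⟨z,Ex⟩ : ∀ z x → ⟨ z , E *ᵥ x ⟩ ≈ 1# * ⟨ z , P *ᵥ x ⟩ + (- (c * ⟨ u , x ⟩)) * ⟨ z , u ⟩
        ⟨z,Ex⟩ z x = ⟨⟩-linʳ z 1# (P *ᵥ x) (- (c * ⟨ u , x ⟩)) u (Ex x)

        into′ : ∀ x → E *ᵥ x ∈ Orthogonal r
        into′ x zero = begin
          ⟨ r₀ , E *ᵥ x ⟩
            ≈⟨ ⟨z,Ex⟩ r₀ x ⟩
          1# * ⟨ r₀ , P *ᵥ x ⟩ + (- (c * ⟨ u , x ⟩)) * ⟨ r₀ , u ⟩
            ≈⟨ +-cong (*-congˡ (trans (sym (⟨Ex,y⟩≈⟨x,y⟩ r₀ (P *ᵥ x) (into x))) (trans (⟨⟩-comm u (P *ᵥ x))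
                 (trans (⟨Ex,y⟩≈⟨x,y⟩ x u (into r₀)) (⟨⟩-comm x u)))))
                 (*-congˡ (sym (⟨Ex,y⟩≈⟨x,y⟩ r₀ u (into r₀)))) ⟩
          1# * ⟨ u , x ⟩ + (- (c * ⟨ u , x ⟩)) * ⟨ u , u ⟩
            ≈⟨ solve 3 (λ c k q → con 1ℚ :* k :+ (:- (c :* k)) :* q := k :* (con 1ℚ :- q :* c)) refl c ⟨ u , x ⟩ ⟨ u , u ⟩ ⟩
          ⟨ u , x ⟩ * (1# - ⟨ u , u ⟩ * c)
            ≈⟨ *-congˡ (trans (+-congˡ (-‿cong uu*c≈1)) (-‿inverseʳ 1#)) ⟩
          ⟨ u , x ⟩ * 0#
            ≈⟨ zeroʳ ⟨ u , x ⟩ ⟩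
          0# ∎
        into′ x (suc i) = begin
          ⟨ r (suc i) , E *ᵥ x ⟩
            ≈⟨ ⟨z,Ex⟩ (r (suc i)) x ⟩
          1# * ⟨ r (suc i) , P *ᵥ x ⟩ + (- (c * ⟨ u , x ⟩)) * ⟨ r (suc i) , u ⟩
            ≈⟨ +-cong (*-congˡ (into x i)) (*-congˡ (into r₀ i)) ⟩
          1# * 0# + (- (c * ⟨ u , x ⟩)) * 0#
            ≈⟨ solve 1 (λ k → con 1ℚ :* con 0ℚ :+ k :* con 0ℚ := con 0ℚ) refl (- (c * ⟨ u , x ⟩)) ⟩
          0# ∎

        orthogonal′ : ∀ x y → y ∈ Orthogonal r → ⟨ x -ᵥ E *ᵥ x , y ⟩ ≈ 0#
        orthogonal′ x y y∈ = begin
          ⟨ x -ᵥ E *ᵥ x , y ⟩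
            ≈⟨ ⟨⟩-linˡ y 1# (x -ᵥ P *ᵥ x) (c * ⟨ u , x ⟩) u (λ v → trans (+-congˡ (-‿cong (Ex x v)))
                 (solve 4 (λ x p k q → x :- (con 1ℚ :* p :+ (:- k) :* q) := con 1ℚ :* (x :- p) :+ k :* q)
                   refl (x v) ((P *ᵥ x) v) (c * ⟨ u , x ⟩) (u v))) ⟩
          1# * ⟨ x -ᵥ P *ᵥ x , y ⟩ + c * ⟨ u , x ⟩ * ⟨ u , y ⟩
            ≈⟨ +-cong (*-congˡ (orthogonal x y (y∈ ∘ suc)))
                 (*-congˡ (trans (⟨Ex,y⟩≈⟨x,y⟩ r₀ y (y∈ ∘ suc)) (y∈ zero))) ⟩
          1# * 0# + c * ⟨ u , x ⟩ * 0#
            ≈⟨ solve 1 (λ k → con 1ℚ :* con 0ℚ :+ k :* con 0ℚ := con 0ℚ) refl (c * ⟨ u , x ⟩) ⟩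
          0# ∎

  -- The θ-eigenspace is the orthogonal complement of the rows of A - θ.
  eigenprojection : ∀ A θ → ∃[ E ] IsE A θ E
  eigenprojection A θ =
    let E , proj = project r in E , record
      { into       = λ x → eigen (IsOrthogonalProjection.into proj x)
      ; orthogonal = λ x y y∈ → IsOrthogonalProjection.orthogonal proj x y λ i →
          trans (⟨r,y⟩ i y) (trans (+-congʳ (y∈ (to i))) (-‿inverseʳ (θ * y (to i))))
      }
    where
    r : Fin n → Vect
    r i v = A (to i) v - θ * e (to i) v

    ⟨r,y⟩ : ∀ i y → ⟨ r i , y ⟩ ≈ (A *ᵥ y) (to i) - θ * y (to i)
    ⟨r,y⟩ i y = begin
      ⟨ r i , y ⟩
        ≈⟨ ⟨⟩-linˡ y 1# (A (to i)) (- θ) (e (to i)) (λ v →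
             solve 3 (λ a t d → a :- t :* d := con 1ℚ :* a :+ (:- t) :* d) refl (A (to i) v) θ (e (to i) v)) ⟩
      1# * (A *ᵥ y) (to i) + (- θ) * ⟨ e (to i) , y ⟩
        ≈⟨ +-congˡ (*-congˡ (⟨e,x⟩ (to i) y)) ⟩
      1# * (A *ᵥ y) (to i) + (- θ) * y (to i)
        ≈⟨ solve 3 (λ a t d → con 1ℚ :* a :+ (:- t) :* d := a :- t :* d) refl ((A *ᵥ y) (to i)) θ (y (to i)) ⟩
      (A *ᵥ y) (to i) - θ * y (to i) ∎

    eigen : ∀ {y} → y ∈ Orthogonal r → y ∈ Eigenspace A θ
    eigen {y} y∈ v = subst (λ u → (A *ᵥ y) u ≈ θ * y u) (strictlyInverseˡ v)
      (x∙y⁻¹≈ε⇒x≈y _ _ (trans (sym (⟨r,y⟩ (from v) y)) (y∈ (from v))))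
      where open GroupProperties +-group

  -- The linear combination enters as a vector w pointwise equal to it, so linearity includes
  -- compatibility with `_≈ᵥ_`.
  IsLinear : (Vect → Vect) → Set
  IsLinear f = ∀ {w} c x d y → (∀ v → w v ≈ c * x v + d * y v) → ∀ v → f w v ≈ c * f x v + d * f y v

  *ᵥ-linear : ∀ A → IsLinear (A *ᵥ_)
  *ᵥ-linear A c x d y w≈ u = ⟨⟩-linʳ (A u) c x d y w≈

  fold-linear : ∀ {f} → IsLinear f → ∀ k → IsLinear (λ x → fold x f k)
  fold-linear lin zero    c x d y w≈ = w≈
  fold-linear lin (suc k) c x d y w≈ = lin c _ d _ (fold-linear lin k c x d y w≈)

  •-linear : ∀ {f} → IsLinear f → ∀ {x y} c → x ≈ᵥ c • y → f x ≈ᵥ c • f y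
  •-linear {f} lin {x} {y} c x≈cy v = trans
    (lin c y 0# y (λ u → trans (x≈cy u) (solve 2 (λ c y → c :* y := c :* y :+ con 0ℚ :* y) refl c (y u))) v)
    (solve 2 (λ c y → c :* y :+ con 0ℚ :* y := c :* y) refl c (f y v))

  fold-eigen : ∀ {f} → IsLinear f → ∀ {θ y} → f y ≈ᵥ θ • y → ∀ k → fold y f k ≈ᵥ θ ^ k • y
  fold-eigen lin {θ} {y} fy≈θy zero    v = sym (*-identityˡ (y v))
  fold-eigen {f} lin {θ} {y} fy≈θy (suc k) v = begin
    f (fold y f k) v        ≈⟨ •-linear lin (θ ^ k) (fold-eigen lin fy≈θy k) v ⟩
    θ ^ k * f y v           ≈⟨ *-congˡ (fy≈θy v) ⟩
    θ ^ k * (θ * y v)       ≈⟨ solve 3 (λ p t y → p :* (t :* y) := t :* p :* y) refl (θ ^ k) θ (y v) ⟩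
    θ * θ ^ k * y v         ∎

  -- Eigenspaces of powers, and supports read on eigenvectors.

  Eigenspace-resp : ∀ A {θ φ} y → θ ≈ φ → y ∈ Eigenspace A θ → y ∈ Eigenspace A φ
  Eigenspace-resp A y θ≈φ y∈ v = trans (y∈ v) (*-congʳ θ≈φ)

  Eigenspace-^ : ∀ A {θ} k y → y ∈ Eigenspace A θ → y ∈ Eigenspace (A ^ₘ k) (θ ^ k)
  Eigenspace-^ A k y y∈ v = trans (^ₘ-*ᵥ A k y v) (fold-eigen (*ᵥ-linear A) y∈ k v)

  -- If E e_v vanished, so would y_v = ⟨ E e_v , y ⟩.
  supp-intro : ∀ A v θ y → y ∈ Eigenspace A θ → ¬ y v ≈ 0# → θ ∈ supp A (e v)
  supp-intro A v θ y y∈ yv≉0 =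
    (y , y∈ , λ y≈0 → yv≉0 (y≈0 v)) ,
    let E , isE = eigenprojection A θ in
    E , isE , λ Ee≈0 → yv≉0 (trans (OrthogonalProjection.y-entry isE v y y∈) (⟨⟩-zeroˡ {E *ᵥ e v} y Ee≈0))

  -- Every column E e_w is an eigenvector, and its entry at v is the entry of E e_v at w. If all
  -- these vanished, E e_v would be 0.
  supp-elim : ∀ A v θ → θ ∈ supp A (e v) → ∃[ y ] (y ∈ Eigenspace A θ × ¬ y v ≈ 0#)
  supp-elim A v θ (_ , E , isE , Ee≉0) = ¬¬-elim λ none → Ee≉0 λ w →
    trans (E-entry v w) (¬¬-elim λ ≉0 → none (E *ᵥ e w , into (e w) , ≉0))
    where open OrthogonalProjection isE

  -- Strong cospectrality as a sign condition on eigenvectors.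

  module _ (a b : V) where

    Parallel : Matrix → ℝ → Sign → Set
    Parallel A θ τ = ∀ y → y ∈ Eigenspace A θ → y b ≈ ⟦ τ ⟧ * y a

    Parallel-unique : ∀ (y : Vect) τ υ → ¬ y a ≈ 0# → y b ≈ ⟦ τ ⟧ * y a → y b ≈ ⟦ υ ⟧ * y a → τ ≡ υ
    Parallel-unique y τ υ ya≉0 p q = compare τ υ (trans (sym p) q)
      where
      ± : ¬ 1# * y a ≈ - 1# * y a
      ± eq = ya≉0 (x≈-x⇒x≈0 (trans (sym (*-identityˡ (y a)))
        (trans eq (solve 1 (λ y → (:- con 1ℚ) :* y := :- y) refl (y a)))))
      compare : ∀ τ υ → ⟦ τ ⟧ * y a ≈ ⟦ υ ⟧ * y a → τ ≡ υ
      compare Sign.+ Sign.+ eq = ≡.refl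
      compare Sign.+ Sign.- eq = contradiction eq ±
      compare Sign.- Sign.+ eq = contradiction (sym eq) ±
      compare Sign.- Sign.- eq = ≡.refl

    module _ {A : Matrix} (sc : StronglyCospectral A a b) where
      open StronglyCospectral sc

      σ-Parallel : ∀ θ (p : θ ∈ supp A (e a)) → Parallel A θ (σ θ p)
      σ-Parallel θ p y y∈ = let E , isE , Eeb≈ = σ-spec θ p in begin
        y b                                    ≈⟨ OrthogonalProjection.y-entry isE b y y∈ ⟩
        ⟨ E *ᵥ e b , y ⟩                       ≈⟨ ⟨⟩-comm (E *ᵥ e b) y ⟩
        ⟨ y , E *ᵥ e b ⟩                       ≈⟨ ⟨⟩-congʳ y Eeb≈ ⟩
        ⟨ y , ⟦ σ θ p ⟧ • (E *ᵥ e a) ⟩         ≈⟨ ⟨⟩-•ʳ y ⟦ σ θ p ⟧ (E *ᵥ e a) ⟩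
        ⟦ σ θ p ⟧ * ⟨ y , E *ᵥ e a ⟩           ≈⟨ *-congˡ (trans (⟨⟩-comm y (E *ᵥ e a)) (sym (OrthogonalProjection.y-entry isE a y y∈))) ⟩
        ⟦ σ θ p ⟧ * y a                        ∎

      -- Off the common support every θ-eigenvector vanishes at both a and b, so the sign is free.
      off-supp : ∀ θ → θ ∉ supp A (e a) → ∀ τ → Parallel A θ τ
      off-supp θ θ∉ τ y y∈ = trans yb≈0 (sym (trans (*-congˡ ya≈0) (zeroʳ ⟦ τ ⟧)))
        where
        ya≈0 : y a ≈ 0#
        ya≈0 = ¬¬-elim λ ya≉0 → θ∉ (supp-intro A a θ y y∈ ya≉0)
        yb≈0 : y b ≈ 0#
        yb≈0 = ¬¬-elim λ yb≉0 → θ∉ (proj₂ same-supp (supp-intro A b θ y y∈ yb≉0))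

      sc⇒Parallel : ∀ θ → ∃[ τ ] Parallel A θ τ
      sc⇒Parallel θ with em {θ ∈ supp A (e a)}
      ... | yes p = σ θ p , σ-Parallel θ p
      ... | no θ∉ = Sign.+ , off-supp θ θ∉ Sign.+

    Parallel⇒sc : ∀ {A} → (∀ θ → ∃[ τ ] Parallel A θ τ) → StronglyCospectral A a b
    Parallel⇒sc {A} par = record
      { same-supp = (λ {θ} p → let y , y∈ , ya≉0 = supp-elim A a θ p ; τ , h = par θ in
                      -- If y_b = τ y_a were 0, multiplying by τ would give y_a = 0, as τ² = 1.
                      supp-intro A b θ y y∈ λ yb≈0 → ya≉0 (trans (sym (⟦τ⟧*⟦τ⟧*x≈x τ (y a)))
                        (trans (*-congˡ (trans (sym (h y y∈)) yb≈0)) (zeroʳ ⟦ τ ⟧))))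
                  , (λ {θ} p → let y , y∈ , yb≉0 = supp-elim A b θ p ; τ , h = par θ in
                      supp-intro A a θ y y∈ λ ya≈0 → yb≉0 (trans (h y y∈) (trans (*-congˡ ya≈0) (zeroʳ ⟦ τ ⟧))))
      ; σ         = λ θ _ → proj₁ (par θ)
      ; σ-spec    = λ θ _ → let E , isE = eigenprojection A θ ; τ , h = par θ in
                      E , isE , same-column τ isE h
      }
      where
      -- By symmetry of `E`, the entries at v of its columns a and b are the entries at a and b of
      -- the eigenvector E e_v.
      same-column : ∀ {E θ} τ → IsE A θ E → Parallel A θ τ → E *ᵥ e b ≈ᵥ ⟦ τ ⟧ • (E *ᵥ e a)
      same-column {E} τ isE h v =
        trans (E-entry b v) (trans (h (E *ᵥ e v) (into (e v))) (*-congˡ (E-entry v a)))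
        where open OrthogonalProjection isE

    -- When only one of θ and -θ lies in the support, the free sign of the other is chosen to match
    -- it.
    common-sign : ∀ {A} (sc : StronglyCospectral A a b) → SignsAgree sc →
                  ∀ θ → ∃[ τ ] (Parallel A θ τ × Parallel A (- θ) τ)
    common-sign {A} sc agree θ with em {θ ∈ supp A (e a)} | em { - θ ∈ supp A (e a)}
    ... | yes p | yes q = σ θ p , σ-Parallel sc θ p ,
                          subst (Parallel A (- θ)) (≡.sym (agree θ p q)) (σ-Parallel sc (- θ) q)
      where open StronglyCospectral sc
    ... | yes p | no q∉ = σ θ p , σ-Parallel sc θ p , off-supp sc (- θ) q∉ (σ θ p)
      where open StronglyCospectral sc
    ... | no p∉ | yes q = σ (- θ) q , off-supp sc θ p∉ (σ (- θ) q) , σ-Parallel sc (- θ) q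
      where open StronglyCospectral sc
    ... | no p∉ | no q∉ = Sign.+ , off-supp sc θ p∉ Sign.+ , off-supp sc (- θ) q∉ Sign.+

  -- Positivity and roots for powers of a symmetric matrix.

  module _ {H : Matrix} (H-sym : IsSymmetric H) where

    T T² : Vect → Vect
    T x  = H *ᵥ x
    T² x = T (T x)

    T-linear : IsLinear T
    T-linear = *ᵥ-linear H

    T²-linear : IsLinear T²
    T²-linear c x d y w≈ = T-linear c (T x) d (T y) (T-linear c x d y w≈)

    T-adjoint : ∀ x y → ⟨ T x , y ⟩ ≈ ⟨ x , T y ⟩
    T-adjoint = *ᵥ-adjoint H-sym

    Tᵏ-adjoint : ∀ k x y → ⟨ fold x T k , y ⟩ ≈ ⟨ x , fold y T k ⟩
    Tᵏ-adjoint zero    x y = refl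
    Tᵏ-adjoint (suc k) x y = begin
      ⟨ T (fold x T k) , y ⟩   ≈⟨ T-adjoint (fold x T k) y ⟩
      ⟨ fold x T k , T y ⟩     ≈⟨ Tᵏ-adjoint k x (T y) ⟩
      ⟨ x , fold (T y) T k ⟩   ≡⟨ cong ⟨ x ,_⟩ (fold-comm T k y) ⟩
      ⟨ x , T (fold y T k) ⟩   ∎

    -- By self-adjointness the inner product is the squared norm of Hᵏ x.
    0≤⟨T²ᵏx,x⟩ : ∀ k x → 0# ≤ ⟨ fold x T² k , x ⟩
    0≤⟨T²ᵏx,x⟩ k x = ≤-respʳ-≈
      (trans (sym (Tᵏ-adjoint k (fold x T k) x)) (reflexive (cong ⟨_, x ⟩ (≡.sym (fold-∘ T k x)))))
      (0≤⟨x,x⟩ (fold x T k))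

    -- The squared norm of H x equals ⟨ x , H² x ⟩ = 0.
    T²x≈0⇒Tx≈0 : ∀ x → T² x ≈ᵥ 0ᵥ → T x ≈ᵥ 0ᵥ
    T²x≈0⇒Tx≈0 x h = ⟨x,x⟩≈0⇒x≈0 (trans (T-adjoint x (T x)) (⟨⟩-zeroʳ x h))

    Tᵏx≈0⇒Tx≈0 : ∀ k x → fold x T (suc k) ≈ᵥ 0ᵥ → T x ≈ᵥ 0ᵥ
    Tᵏx≈0⇒Tx≈0 zero    x h = h
    Tᵏx≈0⇒Tx≈0 (suc k) x h = Tᵏx≈0⇒Tx≈0 k x (T²x≈0⇒Tx≈0 (fold x T k) h)

    -- Σ_{i<k} c^{k−1−i} H^{2i}, the quotient of H^{2k} − c^k by H² − c.
    quotient : ℝ → ℕ → Vect → Vect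
    quotient c zero    z v = 0#
    quotient c (suc k) z v = fold z T² k v + c * quotient c k z v

    -- The geometric-sum identity applied to y. Putting H² y = z + c y into the innermost
    -- application gives the recursion of `quotient`.
    factor : ∀ c k y z → (∀ v → z v ≈ T² y v - c * y v) →
             ∀ v → fold y T² k v ≈ c ^ k * y v + quotient c k z v
    factor c zero    y z z≈ v = solve 1 (λ y → y := con 1ℚ :* y :+ con 0ℚ) refl (y v)
    factor c (suc k) y z z≈ v = begin
      T² (fold y T² k) v
        ≡⟨ cong (λ x → x v) (fold-comm T² k y) ⟨
      fold (T² y) T² k v
        ≈⟨ fold-linear T²-linear k 1# z c y (λ u → trans
             (solve 2 (λ t s → t := con 1ℚ :* (t :- s) :+ s) refl (T² y u) (c * y u))
             (+-congʳ (*-congˡ (sym (z≈ u))))) v ⟩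
      1# * fold z T² k v + c * fold y T² k v
        ≈⟨ +-congˡ (*-congˡ (factor c k y z z≈ v)) ⟩
      1# * fold z T² k v + c * (c ^ k * y v + quotient c k z v)
        ≈⟨ solve 5 (λ t c p y q → con 1ℚ :* t :+ c :* (p :* y :+ q) := c :* p :* y :+ (t :+ c :* q))
             refl (fold z T² k v) c (c ^ k) (y v) (quotient c k z v) ⟩
      c * c ^ k * y v + (fold z T² k v + c * quotient c k z v) ∎

    ⟨quotient,z⟩ : ∀ c k z → ⟨ quotient c (suc k) z , z ⟩ ≈ ⟨ fold z T² k , z ⟩ + c * ⟨ quotient c k z , z ⟩
    ⟨quotient,z⟩ c k z = trans
      (⟨⟩-linˡ z 1# (fold z T² k) c (quotient c k z) λ v → +-congʳ (sym (*-identityˡ (fold z T² k v))))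
      (+-congʳ (*-identityˡ ⟨ fold z T² k , z ⟩))

    module _ {c} (0≤c : 0# ≤ c) where
      0≤⟨quotient,z⟩ : ∀ k z → 0# ≤ ⟨ quotient c k z , z ⟩
      0≤⟨quotient,z⟩ zero    z = ≈⇒≤ (sym (⟨⟩-zeroˡ {0ᵥ} z λ _ → refl))
      0≤⟨quotient,z⟩ (suc k) z = ≤-respʳ-≈ (sym (⟨quotient,z⟩ c k z))
        (0≤x+y (0≤⟨T²ᵏx,x⟩ k z) (0≤x*y 0≤c (0≤⟨quotient,z⟩ k z)))

      -- All summands of the form are nonnegative. The induction drops the one with the highest
      -- power of H and cancels c, until ⟨ z , z ⟩ = 0 remains.
      ⟨quotient,z⟩≈0⇒z≈0 : ¬ c ≈ 0# → ∀ k z → ⟨ quotient c (suc k) z , z ⟩ ≈ 0# → z ≈ᵥ 0ᵥ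
      ⟨quotient,z⟩≈0⇒z≈0 c≉0 zero z h = ⟨x,x⟩≈0⇒x≈0
        (x+y≈0⇒x≈0 (0≤⟨x,x⟩ z) (0≤x*y 0≤c (0≤⟨quotient,z⟩ 0 z)) (trans (sym (⟨quotient,z⟩ c 0 z)) h))
      ⟨quotient,z⟩≈0⇒z≈0 c≉0 (suc k) z h = ⟨quotient,z⟩≈0⇒z≈0 c≉0 k z (x*y≈0⇒y≈0 c≉0
        (x+y≈0⇒x≈0 (0≤x*y 0≤c (0≤⟨quotient,z⟩ (suc k) z)) (0≤⟨T²ᵏx,x⟩ (suc k) z)
          (trans (+-comm _ _) (trans (sym (⟨quotient,z⟩ c (suc k) z)) h))))

      -- For z = H² y - c y, the hypothesis and `factor` show that the quotient sends z to 0; by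
      -- definiteness z = 0.
      T²-root : ¬ c ≈ 0# → ∀ k y → fold y T² (suc k) ≈ᵥ c ^ suc k • y → T² y ≈ᵥ c • y
      T²-root c≉0 k y h v = x∙y⁻¹≈ε⇒x≈y _ _
        (⟨quotient,z⟩≈0⇒z≈0 c≉0 k z (⟨⟩-zeroˡ {quotient c (suc k) z} z λ u →
          identityʳ-unique (c ^ suc k * y u) _ (trans (sym (factor c (suc k) y z (λ _ → refl) u)) (h u))) v)
        where
        open GroupProperties +-group
        z : Vect
        z v = T² y v - c * y v

    module _ (k : ℕ) {μ : ℝ} where

      Hᵏ-kernel : μ ≈ 0# → ∀ y → y ∈ Eigenspace (H ^ₘ suc k) μ → y ∈ Eigenspace H 0#
      Hᵏ-kernel μ≈0 y y∈ v = trans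
        (Tᵏx≈0⇒Tx≈0 k y (λ u → trans (sym (^ₘ-*ᵥ H (suc k) y u))
          (trans (y∈ u) (trans (*-congʳ μ≈0) (zeroˡ (y u))))) v)
        (sym (zeroˡ (y v)))

      -- The witness θ depends on μ alone, since one sign has to serve the whole μ-eigenspace.
      Hᵏ-root : ¬ μ ≈ 0# → ∃[ θ ] (¬ θ ≈ 0# × (∀ y → y ∈ Eigenspace (H ^ₘ suc k) μ → T² y ≈ᵥ (θ * θ) • y))
      -- The root is taken of μ², which is nonnegative for either sign of μ. As `root` takes the
      -- exponent less one, this is a root of order 2(k + 1).
      Hᵏ-root μ≉0 = from-root (root (k ℕ.+ suc k) (0≤x*x μ))
        where
        from-root : ∃[ θ ] θ ^ (suc k ℕ.+ suc k) ≈ μ * μ →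
                    ∃[ θ ] (¬ θ ≈ 0# × (∀ y → y ∈ Eigenspace (H ^ₘ suc k) μ → T² y ≈ᵥ (θ * θ) • y))
        from-root (θ , θ^≈) = θ , θ≉0 , λ y y∈ →
          T²-root (0≤x*x θ) (θ≉0 ∘ x*x≈0⇒x≈0) k y (T²ᵏ y (λ v → trans (sym (^ₘ-*ᵥ H (suc k) y v)) (y∈ v)))
          where
          θ≉0 : ¬ θ ≈ 0#
          θ≉0 θ≈0 = μ≉0 (x*x≈0⇒x≈0 (trans (sym θ^≈) (trans (*-congʳ θ≈0) (zeroˡ _))))

          T²ᵏ : ∀ y → fold y T (suc k) ≈ᵥ μ • y → fold y T² (suc k) ≈ᵥ (θ * θ) ^ suc k • y
          T²ᵏ y h v = begin
            fold y T² (suc k) v                   ≡⟨ cong (λ x → x v) (fold-∘ T (suc k) y) ⟩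
            fold (fold y T (suc k)) T (suc k) v   ≈⟨ •-linear (fold-linear T-linear (suc k)) μ h v ⟩
            μ * fold y T (suc k) v                ≈⟨ *-congˡ (h v) ⟩
            μ * (μ * y v)                         ≈⟨ *-assoc μ μ (y v) ⟨
            μ * μ * y v                           ≈⟨ *-congʳ (trans (^-distrib-* θ θ (suc k)) (trans (sym (^-homo-* θ (suc k) (suc k))) θ^≈)) ⟨
            (θ * θ) ^ suc k * y v                 ∎

    -- Strong cospectrality of a matrix and of its powers.

    module _ (a b : V) where

      -- The sign at θ is the one that Hᵏ has at θᵏ.
      power⇒sc : ∀ k → StronglyCospectral (H ^ₘ k) a b → StronglyCospectral H a b
      power⇒sc k sc = Parallel⇒sc a b λ θ → let τ , par = sc⇒Parallel a b sc (θ ^ k) in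
        τ , λ y y∈ → par y (Eigenspace-^ H k y y∈)

      module _ (sc : StronglyCospectral H a b) where

        sc⇒power : SignsAgree sc → ∀ k → StronglyCospectral (H ^ₘ suc k) a b
        sc⇒power agree k = Parallel⇒sc a b par
          where
          par : ∀ μ → ∃[ τ ] Parallel a b (H ^ₘ suc k) μ τ
          par μ with em {μ ≈ 0#}
          ... | yes μ≈0 = let τ , h = sc⇒Parallel a b sc 0# in
            τ , λ y y∈ → h y (Hᵏ-kernel k μ≈0 y y∈)
          ... | no μ≉0 =
            let θ , θ≉0 , T²≈ = Hᵏ-root k μ≉0
                τ , h₊ , h₋ = common-sign a b sc agree θ
            in τ , λ y y∈ → combine θ θ≉0 τ h₊ h₋ y (T²≈ y y∈)
            where
            combine : ∀ θ → ¬ θ ≈ 0# → ∀ τ → Parallel a b H θ τ → Parallel a b H (- θ) τ →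
                      ∀ y → T² y ≈ᵥ (θ * θ) • y → y b ≈ ⟦ τ ⟧ * y a
            -- The components y₊ and y₋ share the sign τ, so their sum 2θ y has it too, and 2θ
            -- cancels.
            combine θ θ≉0 τ h₊ h₋ y T²y≈ = *-cancelˡ θ+θ≉0 (begin
              (θ + θ) * y b
                ≈⟨ split b ⟩
              y₊ b + y₋ b
                ≈⟨ +-cong (h₊ y₊ y₊∈) (h₋ y₋ y₋∈) ⟩
              ⟦ τ ⟧ * y₊ a + ⟦ τ ⟧ * y₋ a
                ≈⟨ distribˡ ⟦ τ ⟧ (y₊ a) (y₋ a) ⟨
              ⟦ τ ⟧ * (y₊ a + y₋ a)
                ≈⟨ *-congˡ (split a) ⟨
              ⟦ τ ⟧ * ((θ + θ) * y a)
                ≈⟨ solve 3 (λ t c y → t :* (c :* y) := c :* (t :* y)) refl ⟦ τ ⟧ (θ + θ) (y a) ⟩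
              (θ + θ) * (⟦ τ ⟧ * y a) ∎)
              where
              θ+θ≉0 : ¬ θ + θ ≈ 0#
              θ+θ≉0 h = θ≉0 (x≈-x⇒x≈0 (inverseʳ-unique θ θ h))
                where open GroupProperties +-group

              y₊ y₋ : Vect
              y₊ v = θ * y v + 1# * T y v
              y₋ v = θ * y v + - 1# * T y v

              split : ∀ v → (θ + θ) * y v ≈ y₊ v + y₋ v
              split v = solve 3 (λ t y h → (t :+ t) :* y := (t :* y :+ con 1ℚ :* h) :+ (t :* y :+ (:- con 1ℚ) :* h))
                refl θ (y v) (T y v)

              y₊∈ : y₊ ∈ Eigenspace H θ
              y₊∈ v = begin
                T y₊ v                           ≈⟨ T-linear θ y 1# (T y) (λ _ → refl) v ⟩
                θ * T y v + 1# * T² y v          ≈⟨ +-congˡ (*-congˡ (T²y≈ v)) ⟩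
                θ * T y v + 1# * (θ * θ * y v)   ≈⟨ solve 3 (λ t y h → t :* h :+ con 1ℚ :* (t :* t :* y) := t :* (t :* y :+ con 1ℚ :* h)) refl θ (y v) (T y v) ⟩
                θ * y₊ v                         ∎

              y₋∈ : y₋ ∈ Eigenspace H (- θ)
              y₋∈ v = begin
                T y₋ v                             ≈⟨ T-linear θ y (- 1#) (T y) (λ _ → refl) v ⟩
                θ * T y v + - 1# * T² y v          ≈⟨ +-congˡ (*-congˡ (T²y≈ v)) ⟩
                θ * T y v + - 1# * (θ * θ * y v)   ≈⟨ solve 3 (λ t y h → t :* h :+ (:- con 1ℚ) :* (t :* t :* y) := (:- t) :* (t :* y :+ (:- con 1ℚ) :* h)) refl θ (y v) (T y v) ⟩
                - θ * y₋ v                         ∎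

        sc⇒odd-power : ∀ m → StronglyCospectral (H ^ₘ suc (m ℕ.+ m)) a b
        sc⇒odd-power m = Parallel⇒sc a b par
          where
          par : ∀ μ → ∃[ τ ] Parallel a b (H ^ₘ suc (m ℕ.+ m)) μ τ
          par μ with em {μ ≈ 0#}
          ... | yes μ≈0 = let τ , h = sc⇒Parallel a b sc 0# in
            τ , λ y y∈ → h y (Hᵏ-kernel (m ℕ.+ m) μ≈0 y y∈)
          ... | no μ≉0 =
            let θ , θ≉0 , T²≈ = Hᵏ-root (m ℕ.+ m) μ≉0
                i , cᵐi≈1 = inverse (x^k≉0 m (θ≉0 ∘ x*x≈0⇒x≈0))
                -- With c = θ² and i = c⁻ᵐ, the equation μ y = H H²ᵐ y = cᵐ H y makes i μ the
                -- eigenvalue of y under H.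
                τ , h = sc⇒Parallel a b sc (i * μ)
            in τ , λ y y∈ → h y (eigen (θ * θ) i cᵐi≈1 y (T²≈ y y∈)
                 (λ v → trans (sym (^ₘ-*ᵥ H (suc (m ℕ.+ m)) y v)) (y∈ v)))
            where
            eigen : ∀ c i → c ^ m * i ≈ 1# → ∀ y → T² y ≈ᵥ c • y →
                    fold y T (suc (m ℕ.+ m)) ≈ᵥ μ • y → y ∈ Eigenspace H (i * μ)
            eigen c i cᵐi≈1 y T²y≈ h v = begin
              T y v                  ≈⟨ *-identityˡ (T y v) ⟨
              1# * T y v             ≈⟨ *-congʳ cᵐi≈1 ⟨
              c ^ m * i * T y v      ≈⟨ solve 3 (λ c i t → c :* i :* t := i :* (c :* t)) refl (c ^ m) i (T y v) ⟩
              i * (c ^ m * T y v)    ≈⟨ *-congˡ (•-linear T-linear (c ^ m) T²ᵐy≈ v) ⟨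
              i * T (fold y T (m ℕ.+ m)) v   ≈⟨ *-congˡ (h v) ⟩
              i * (μ * y v)          ≈⟨ *-assoc i μ (y v) ⟨
              i * μ * y v            ∎
              where
              T²ᵐy≈ : fold y T (m ℕ.+ m) ≈ᵥ c ^ m • y
              T²ᵐy≈ v = trans
                (reflexive (cong (λ x → x v) (≡.trans (fold-+ y T m) (≡.sym (fold-∘ T m y)))))
                (fold-eigen T²-linear T²y≈ m v)

        -- The eigenspaces of ρ and -ρ lie in one eigenspace of H²ᵐ. Its sign τ equals both σ's,
        -- because each of the two contains a vector that is nonzero at a.
        even-power⇒agree : ∀ m → StronglyCospectral (H ^ₘ (2 ℕ.* m)) a b → SignsAgree sc
        even-power⇒agree m sc′ ρ p q =
          let y , y∈ , ya≉0 = supp-elim H a ρ p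
              z , z∈ , za≉0 = supp-elim H a (- ρ) q
              τ , par = sc⇒Parallel a b sc′ (ρ ^ (2 ℕ.* m))
          in ≡.trans
            (Parallel-unique a b y (σ ρ p) τ ya≉0 (σ-Parallel a b sc ρ p y y∈) (par y (Eigenspace-^ H (2 ℕ.* m) y y∈)))
            (≡.sym (Parallel-unique a b z (σ (- ρ) q) τ za≉0 (σ-Parallel a b sc (- ρ) q z z∈)
              (par z (Eigenspace-resp (H ^ₘ (2 ℕ.* m)) z -ρ^≈ (Eigenspace-^ H (2 ℕ.* m) z z∈)))))
          where
          open StronglyCospectral sc
          -ρ^≈ : (- ρ) ^ (2 ℕ.* m) ≈ ρ ^ (2 ℕ.* m)
          -ρ^≈ = begin
            (- ρ) ^ (2 ℕ.* m)   ≈⟨ ^-assocʳ (- ρ) 2 m ⟨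
            ((- ρ) ^ 2) ^ m     ≈⟨ ^-congˡ m (solve 1 (λ r → (:- r) :* ((:- r) :* con 1ℚ) := r :* (r :* con 1ℚ)) refl ρ) ⟩
            (ρ ^ 2) ^ m         ≈⟨ ^-assocʳ ρ 2 m ⟩
            ρ ^ (2 ℕ.* m)       ∎

-- Determination of `𝒢` by the sign condition and the parity of k.

theorem2p4 : ExcludedMiddle 0ℓ →
    {V : Set} {n : ℕ} (enum : Fin n ↔ V) →
    let open Spectral enum in
    (H : Matrix) → IsSymmetric H →
    (a b : V) → a ≢ b →
    (¬ StronglyCospectral H a b → 𝒢 H a b ≐ ∅) ×
    ((sc : StronglyCospectral H a b) →
    (SignsAgree sc → 𝒢 H a b ≐ ℕ⁺) ×
    (¬ SignsAgree sc → 𝒢 H a b ≐ 2ℕ+1))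
theorem2p4 em enum H H-sym a b _ =
  (λ ¬sc → (λ {k} (_ , sc′) → ¬sc (power⇒sc H-sym a b k sc′)) , λ ()) ,
  λ sc →
    (λ agree → proj₁ , λ { {suc k} 0<k → 0<k , sc⇒power H-sym a b sc agree k }) ,
    λ ¬agree →
      (λ {k} (_ , sc′) → [ (λ { (m , ≡.refl) → contradiction (even-power⇒agree H-sym a b sc m sc′) ¬agree })
                         , (λ odd → odd) ]′ (even∨odd k)) ,
      λ { (m , ≡.refl) → subst (𝒢 H a b) (suc[m+m]≡ m) (ℕ.s≤s ℕ.z≤n , sc⇒odd-power H-sym a b sc m) }
  where
  open Spectral enum
  open SpectralTheory em enum
  suc[m+m]≡ : ∀ m → suc (m ℕ.+ m) ≡ 2 ℕ.* m ℕ.+ 1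
  suc[m+m]≡ m = ≡.trans (cong (λ j → suc (m ℕ.+ j)) (≡.sym (ℕ.+-identityʳ m))) (ℕ.+-comm 1 (2 ℕ.* m))
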